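{- There is a deterministic distributed algorithm in the $\mathsf{CONGEST}$ model with the following guarantee. Let $G=(V,E)$ be an arbitrary undirected unweighted $n$-node network graph in which each node has a unique $b = O(\log n)$-bit identifier. In $O(\log^6 n)$ rounds the algorithm finds a subset $V' \subseteq V$ with $|V'| \ge |V|/2$ such that the induced subgraph $G[V']$ is partitioned into pairwise non-adjacent, disjoint clusters, each cluster $C$ having the property that the diameter of $G[C]$ (distances measured inside the induced subgraph $G[C]$) is $O(\log^3 n)$.
   Context: The $\mathsf{CONGEST}$ model: the network is an $n$-node undirected graph $G=(V,E)$, each node is a processor knowing its own unique $O(\log n)$-bit identifier and a polynomial upper bound on $n$, but not the topology. Computation proceeds in synchronous rounds; in each round every node may send one $O(\log n)$-bit message to each of its neighbors, then performs local computation. At the end each node must know its own part of the output (here, whether it is in $V'$ and which cluster it belongs to). $G[U]$ denotes the subgraph induced by $U\subseteq V$. Two clusters $C_1 \ne C_2$ are non-adjacent if no edge of $G$ joins a vertex of $C_1$ to a vertex of $C_2$. The diameter of a graph $H$ is $\max_{u,v\in V(H)} d_H(u,v)$. -}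

module Defs where

open import Data.Nat using (ℕ; zero; suc; _+_; _*_; _^_; _≤_; _<_)
open import Data.Nat.Logarithm using (⌊log₂_⌋)
open import Data.Fin using (Fin; toℕ)
open import Data.Bool using (Bool; true; false; if_then_else_)
open import Data.List using (List; take)
open import Data.Product using (Σ; ∃; ∃-syntax; _×_; _,_; proj₁; proj₂)
open import Data.Vec.Functional using (Vector)
import Data.List as L
open import Relation.Binary.PropositionalEquality using (_≡_; _≢_)
open import Relation.Nullary using (¬_)
open import Function.Definitions using (Injective)

-- Port-numbered simple undirected network on node set Fin n.
-- Node v has deg v ports; port v p is the neighbour behind port p, and
-- back v p is the port number of v at that neighbour.
record Network (n : ℕ) : Set where
  field
    deg       : Fin n → ℕ
    port      : (v : Fin n) → Fin (deg v) → Fin n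
    back      : (v : Fin n) → (p : Fin (deg v)) → Fin (deg (port v p))
    port-back : ∀ v p → port (port v p) (back v p) ≡ v
    port-inj  : ∀ v → Injective _≡_ _≡_ (port v)
    no-loop   : ∀ v p → port v p ≢ v

Adj : ∀ {n} → Network n → Fin n → Fin n → Set
Adj G u v = ∃[ p ] Network.port G u p ≡ v

-- Deterministic CONGEST algorithms.
-- A node initially knows the upper bound N, its own identifier and its
-- degree (number of ports); nothing about the topology.
record Algorithm : Set₁ where
  field
    State  : Set
    init   : (N ident degree : ℕ) → State
    send   : (N : ℕ) → State → (port : ℕ) → List Bool
    -- new state from the messages received, listed by port number
    update : (N : ℕ) → State → List (List Bool) → State
    -- final output: (is the node in V' , cluster label)
    output : State → Bool × ℕ
    -- number of rounds executed (may depend only on the known bound N)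
    rounds : ℕ → ℕ

-- message bandwidth: cB * (1 + ⌊log₂ N⌋) bits; longer messages are truncated
bandwidth : ℕ → ℕ → ℕ
bandwidth cB N = cB * suc ⌊log₂ N ⌋

run : ∀ {n} (A : Algorithm) (cB N : ℕ) (G : Network n) (ident : Fin n → ℕ) →
      ℕ → Fin n → Algorithm.State A
run A cB N G ident zero v = Algorithm.init A N (ident v) (Network.deg G v)
run A cB N G ident (suc r) v =
  Algorithm.update A N (run A cB N G ident r v)
    (L.tabulate λ (p : Fin (Network.deg G v)) →
       take (bandwidth cB N)
         (Algorithm.send A N (run A cB N G ident r (Network.port G v p))
                            (toℕ (Network.back G v p))))

result : ∀ {n} (A : Algorithm) (cB N : ℕ) (G : Network n) (ident : Fin n → ℕ) →
         Fin n → Bool × ℕ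
result A cB N G ident v =
  Algorithm.output A (run A cB N G ident (Algorithm.rounds A N) v)

count : ∀ {n} → (Fin n → Bool) → ℕ
count {n} f = L.length (L.filterᵇ f (L.allFin n))

data WalkIn {n} (G : Network n) (P : Fin n → Set) : Fin n → Fin n → ℕ → Set where
  here : ∀ {u} → P u → WalkIn G P u u zero
  step : ∀ {u w v ℓ} → P u → Adj G u w → WalkIn G P w v ℓ → WalkIn G P u v (suc ℓ)

DistInLe : ∀ {n} (G : Network n) (P : Fin n → Set) → Fin n → Fin n → ℕ → Set
DistInLe G P u v D = ∃[ ℓ ] (ℓ ≤ D × WalkIn G P u v ℓ)

DiamLe : ∀ {n} (G : Network n) (C : Fin n → Set) → ℕ → Set
DiamLe {n} G C D = ∀ (u v : Fin n) → C u → C v → DistInLe G C u v D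

-- Correctness of an output (V' , clusters) for a network G with bound D on
-- cluster diameters.  V' = {v | inV' v ≡ true}; the cluster of v ∈ V' is
-- {u ∈ V' | label u ≡ label v} (clusters are disjoint by construction).
module _ {n : ℕ} (G : Network n) (out : Fin n → Bool × ℕ) where
  inV' : Fin n → Bool
  inV' v = proj₁ (out v)

  Cluster : Fin n → Fin n → Set
  Cluster v u = (inV' u ≡ true) × (proj₂ (out u) ≡ proj₂ (out v))

  GoodClustering : ℕ → Set
  GoodClustering D =
      (n ≤ 2 * count inV')
    × (∀ u v → inV' u ≡ true → inV' v ≡ true → Adj G u v →
         proj₂ (out u) ≡ proj₂ (out v))
    × (∀ v → inV' v ≡ true → DiamLe G (Cluster v) D)

{-# OPTIONS --safe #-}
-- The algorithm of Rozhoň, Haeupler and Grunau.  Every alive node belongs to a rooted tree whose root,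
-- a terminal, gives the tree its name; at first each node is a terminal.  One phase per bit of the
-- identifiers makes adjacent alive nodes agree on that bit of their roots, so at the end adjacent
-- nodes have equal roots and the clusters are the trees.
--
-- A phase starts by rebuilding the forest as a BFS forest from the terminals and calls the trees with
-- bit 1 red, the others blue.  In each of its steps every blue node with a red neighbour attaches
-- itself, with its subtree, to that neighbour.  A red tree accepts the attached nodes if they amount
-- to at least a fraction 1/K of its size, and otherwise has them removed.  A tree can grow by a factor
-- 1 + 1/K only O(K log n) times; after it rejects it has no blue neighbours, ever.  So at most n/K
-- nodes are removed per phase, and K = 2b for b phases leaves half of the nodes.
--
-- BFS levels of neighbours differ by at most 1, hence after t steps a node of level l has depth at most
-- l + 2t.  A phase thus increases the depth by O(K log n) = O(log² n), which gives depth O(log³ n) and,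
-- with a constant number of sweeps of that length in each step, O(log⁶ n) rounds.
module Submission where

open import Defs
open import Data.Nat
open import Data.Nat.Properties
open import Data.Nat.Logarithm
import Data.Nat.ListAction as ListAction
open import Data.Nat.Solver using (module +-*-Solver)
open import Data.Fin as Fin using (Fin; zero; suc; toℕ)
import Data.Fin.Properties as Fin
open import Data.Bool using (Bool; true; false; if_then_else_; not; _∧_; _∨_; T)
open import Data.Bool.Properties using (∧-conicalˡ; ¬-not) renaming (_≟_ to _≟ᵇ_)
open import Data.Maybe as Maybe using (Maybe; just; nothing; maybe; is-just; is-nothing)
open import Data.Maybe.Properties using (just-injective)
open import Data.List as L using (List; []; _∷_; _++_)
import Data.List.Properties as L
open import Data.Product using (Σ; ∃-syntax; _×_; _,_; proj₁; proj₂)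
open import Data.Sum using (_⊎_; inj₁; inj₂)
open import Data.Empty using (⊥-elim)
open import Relation.Nullary
open import Relation.Nullary.Decidable using (dec-true; dec-false)
open import Relation.Unary using (Decidable)
open import Relation.Binary.PropositionalEquality
open import Function using (_∘_; const)
open import Function.Definitions using (Injective)
open import Algebra.Properties.CommutativeMonoid.Sum +-0-commutativeMonoid
  using (sum; sum-cong-≗; ∑-distrib-+; ∑-comm; sum-replicate-zero)
open import Algebra.Properties.Semiring.Sum +-*-semiring using (*-distribˡ-sum)

-- Finite sums, counting and half-edges

sum-mono : ∀ {n} {f g : Fin n → ℕ} → (∀ v → f v ≤ g v) → sum f ≤ sum g
sum-mono {zero}  f≤g = z≤n
sum-mono {suc n} f≤g = +-mono-≤ (f≤g zero) (sum-mono (f≤g ∘ suc))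

sum-zero : ∀ {n} {f : Fin n → ℕ} → (∀ v → f v ≡ 0) → sum f ≡ 0
sum-zero {n} f≡0 = trans (sum-cong-≗ f≡0) (sum-replicate-zero n)

sum-single : ∀ {n} (f : Fin n → ℕ) i → (∀ j → j ≢ i → f j ≡ 0) → sum f ≡ f i
sum-single f zero    f≡0 =
  trans (cong (f zero +_) (sum-zero λ j → f≡0 (suc j) λ ())) (+-identityʳ _)
sum-single f (suc i) f≡0 =
  cong₂ _+_ (f≡0 zero λ ())
    (sum-single (f ∘ suc) i λ j j≢i → f≡0 (suc j) (j≢i ∘ Fin.suc-injective))

≤-sum : ∀ {n} (f : Fin n → ℕ) i → f i ≤ sum f
≤-sum f zero    = m≤m+n _ _
≤-sum f (suc i) = ≤-trans (≤-sum (f ∘ suc) i) (m≤n+m _ _)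

sum-tabulate : ∀ {A : Set} {n} (g : A → ℕ) (f : Fin n → A) →
               ListAction.sum (L.map g (L.tabulate f)) ≡ sum (g ∘ f)
sum-tabulate {n = zero}  g f = refl
sum-tabulate {n = suc n} g f = cong (g (f zero) +_) (sum-tabulate g (f ∘ suc))

𝟙 : ∀ {P : Set} → Dec P → ℕ
𝟙 P? = if does P? then 1 else 0

𝟙-true : ∀ {P : Set} (P? : Dec P) → P → 𝟙 P? ≡ 1
𝟙-true P? p = cong (if_then 1 else 0) (dec-true P? p)

𝟙-false : ∀ {P : Set} (P? : Dec P) → ¬ P → 𝟙 P? ≡ 0
𝟙-false P? ¬p = cong (if_then 1 else 0) (dec-false P? ¬p)

𝟙-mono : ∀ {P Q : Set} (P? : Dec P) (Q? : Dec Q) → (P → Q) → 𝟙 P? ≤ 𝟙 Q?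
𝟙-mono (no _)  Q? P→Q = z≤n
𝟙-mono (yes p) Q? P→Q = ≤-reflexive (sym (𝟙-true Q? (P→Q p)))

𝟙-* : ∀ {P Q : Set} (P? : Dec P) (Q? : Dec Q) → 𝟙 P? * 𝟙 Q? ≡ 𝟙 (P? ×-dec Q?)
𝟙-* (no _)  Q? = refl
𝟙-* (yes _) Q? = +-identityʳ _

𝟙-*-zero : ∀ {P : Set} (P? : Dec P) {x} → (P → x ≡ 0) → 𝟙 P? * x ≡ 0
𝟙-*-zero (no _)  P→0 = refl
𝟙-*-zero (yes p) P→0 = trans (+-identityʳ _) (P→0 p)

𝟙-split : ∀ {P Q : Set} (P? : Dec P) (Q? : Dec Q) →
          𝟙 P? ≡ 𝟙 (P? ×-dec Q?) + 𝟙 (P? ×-dec ¬? Q?)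
𝟙-split (no _)  Q?      = refl
𝟙-split (yes _) (yes _) = refl
𝟙-split (yes _) (no _)  = refl

# : ∀ {n} {P : Fin n → Set} → Decidable P → ℕ
# P? = sum (λ v → 𝟙 (P? v))

module _ {n} {P Q : Fin n → Set} (P? : Decidable P) (Q? : Decidable Q) where

  #-mono : (∀ v → P v → Q v) → # P? ≤ # Q?
  #-mono P⊆Q = sum-mono λ v → 𝟙-mono (P? v) (Q? v) (P⊆Q v)

  #-split : # P? ≡ # (λ v → P? v ×-dec Q? v) + # (λ v → P? v ×-dec ¬? (Q? v))
  #-split = trans (sum-cong-≗ λ v → 𝟙-split (P? v) (Q? v)) (∑-distrib-+ (λ v → 𝟙 (P? v ×-dec Q? v)) _)

module _ {n} {P : Fin n → Set} (P? : Decidable P) where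

  #-zero : (∀ v → ¬ P v) → # P? ≡ 0
  #-zero ¬P = sum-zero λ v → 𝟙-false (P? v) (¬P v)

  #-pos : ∀ v → P v → 1 ≤ # P?
  #-pos v p = subst (_≤ # P?) (𝟙-true (P? v) p) (≤-sum _ v)

  #≤n : # P? ≤ n
  #≤n = go n λ v → 𝟙-≤1 (P? v)
    where
    𝟙-≤1 : ∀ {Q : Set} (Q? : Dec Q) → 𝟙 Q? ≤ 1
    𝟙-≤1 (yes _) = ≤-refl
    𝟙-≤1 (no _)  = z≤n
    go : ∀ m {f : Fin m → ℕ} → (∀ v → f v ≤ 1) → sum f ≤ m
    go zero    f≤1 = z≤n
    go (suc m) f≤1 = +-mono-≤ (f≤1 zero) (go m (f≤1 ∘ suc))

  #-full : (∀ v → P v) → # P? ≡ n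
  #-full all = trans (sum-cong-≗ λ v → 𝟙-true (P? v) (all v)) (ones n)
    where
    ones : ∀ m → sum {m} (λ _ → 1) ≡ m
    ones zero    = refl
    ones (suc m) = cong suc (ones m)

  -- Double counting: the indicator of `P` at `v` is a sum over `r` whose only possibly nonzero term
  -- is `r = ρ v`; then the two sums are exchanged.
  #-partition : ∀ {m} (ρ : Fin n → Fin m) →
                # P? ≡ sum (λ r → # (λ v → (ρ v Fin.≟ r) ×-dec P? v))
  #-partition ρ =
    trans (sum-cong-≗ λ v → sym (trans
             (sum-single _ (ρ v) λ r r≢ → 𝟙-false ((ρ v Fin.≟ r) ×-dec P? v) λ (e , _) → r≢ (sym e))
             (trans (sym (𝟙-* (ρ v Fin.≟ ρ v) (P? v)))
               (trans (cong (_* 𝟙 (P? v)) (𝟙-true (ρ v Fin.≟ ρ v) refl)) (+-identityʳ _)))))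
          (∑-comm λ v r → 𝟙 ((ρ v Fin.≟ r) ×-dec P? v))

count-# : ∀ {n} {P : Fin n → Set} (f : Fin n → Bool) (P? : Decidable P) →
          (∀ v → P v → f v ≡ true) → (∀ v → f v ≡ true → P v) → count f ≡ # P?
count-# {n} f P? to from = go n (λ v → v) P? to from
  where
  -- `allFin` tabulates the identity, and the recursion replaces it by shifted functions, hence the
  -- generalisation to `g`.
  go : ∀ m (g : Fin m → Fin n) {Q : Fin m → Set} (Q? : Decidable Q) →
       (∀ v → Q v → f (g v) ≡ true) → (∀ v → f (g v) ≡ true → Q v) →
       L.length (L.filterᵇ f (L.tabulate g)) ≡ # Q?
  go zero    g Q? to from = refl
  go (suc m) g Q? to from with f (g zero) in eq | Q? zero
  ... | true  | yes _ = cong suc (go m (g ∘ suc) (Q? ∘ suc) (to ∘ suc) (from ∘ suc))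
  ... | true  | no ¬q = ⊥-elim (¬q (from zero eq))
  ... | false | yes q with () ← trans (sym eq) (to zero q)
  ... | false | no _  = go m (g ∘ suc) (Q? ∘ suc) (to ∘ suc) (from ∘ suc)

module _ {n} (G : Network n) where
  open Network G

  -- Both sides sum h over all half-edges, since (v , p) ↦ (port v p , back v p) is an involution.
  handshake : (h : Fin n → ℕ → ℕ) →
              sum (λ v → sum {deg v} λ p → h (port v p) (toℕ (back v p))) ≡
              sum (λ u → sum {deg u} λ q → h u (toℕ q))
  handshake h = begin
    sum (λ v → sum {deg v} λ p → h (port v p) (toℕ (back v p)))
      ≡⟨ sum-cong-≗ (λ v → trans (sum-cong-≗ λ p → spread (port v p) (h (port v p) (toℕ (back v p))))
                     (∑-comm λ p u → 𝟙 (port v p Fin.≟ u) * h (port v p) (toℕ (back v p)))) ⟩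
    sum (λ v → sum λ u → sum λ p → 𝟙 (port v p Fin.≟ u) * h (port v p) (toℕ (back v p)))
      ≡⟨ sum-cong-≗ (λ v → sum-cong-≗ λ u → between v u) ⟩
    sum (λ v → sum λ u → sum λ q → 𝟙 (port u q Fin.≟ v) * h u (toℕ q))
      ≡⟨ ∑-comm (λ v u → sum λ q → 𝟙 (port u q Fin.≟ v) * h u (toℕ q)) ⟩
    sum (λ u → sum λ v → sum λ q → 𝟙 (port u q Fin.≟ v) * h u (toℕ q))
      ≡⟨ sum-cong-≗ (λ u → trans (∑-comm λ v q → 𝟙 (port u q Fin.≟ v) * h u (toℕ q))
                     (sum-cong-≗ {deg u} λ q → sym (spread (port u q) _))) ⟩
    sum (λ u → sum {deg u} λ q → h u (toℕ q)) ∎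
    where
    open ≡-Reasoning
    spread : ∀ (u : Fin n) x → x ≡ sum λ v → 𝟙 (u Fin.≟ v) * x
    spread u x = sym (trans
      (sum-single _ u λ v v≢u → cong (_* x) (𝟙-false (u Fin.≟ v) (v≢u ∘ sym)))
      (trans (cong (_* x) (𝟙-true (u Fin.≟ u) refl)) (+-identityʳ x)))
    -- By `port-inj` at most one port of `v` leads to `u`, so each side has at most one nonzero
    -- term; the two terms belong to the ports `p` and `back v p` of the same edge.
    between : ∀ v u → sum (λ p → 𝟙 (port v p Fin.≟ u) * h (port v p) (toℕ (back v p))) ≡
                      sum (λ q → 𝟙 (port u q Fin.≟ v) * h u (toℕ q))
    between v u with Fin.any? (λ p → port v p Fin.≟ u)
    ... | yes (p , refl) = trans
          (trans (sum-single _ p λ p′ p′≢p → cong (_* h (port v p′) (toℕ (back v p′)))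
                   (𝟙-false (port v p′ Fin.≟ port v p) (p′≢p ∘ port-inj v)))
                 (cong (_* h (port v p) (toℕ (back v p))) (𝟙-true (port v p Fin.≟ port v p) refl)))
          (sym (trans (sum-single _ (back v p) λ q q≢ → cong (_* h (port v p) (toℕ q))
                   (𝟙-false (port (port v p) q Fin.≟ v)
                     λ e → q≢ (port-inj (port v p) (trans e (sym (port-back v p))))))
                 (cong (_* h (port v p) (toℕ (back v p))) (𝟙-true (port (port v p) (back v p) Fin.≟ v) (port-back v p)))))
    ... | no none = trans
          (sum-zero λ p → cong (_* h (port v p) (toℕ (back v p)))
            (𝟙-false (port v p Fin.≟ u) λ e → none (p , e)))
          (sym (sum-zero λ q → cong (_* h u (toℕ q))
            (𝟙-false (port u q Fin.≟ v) λ { refl → none (back u q , port-back u q) })))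

-- Binary representation

odd : ℕ → Bool
odd zero    = false
odd (suc x) = not (odd x)

bit : ℕ → ℕ → Bool
bit zero    x = odd x
bit (suc i) x = bit i ⌊ x /2⌋

bits : ℕ → ℕ → List Bool
bits zero    x = []
bits (suc w) x = odd x ∷ bits w ⌊ x /2⌋

value : List Bool → ℕ
value []       = 0
value (c ∷ cs) = (if c then 1 else 0) + (value cs + value cs)

length-bits : ∀ w x → L.length (bits w x) ≡ w
length-bits zero    x = refl
length-bits (suc w) x = cong suc (length-bits w _)

odd-half : ∀ x → x ≡ (if odd x then 1 else 0) + (⌊ x /2⌋ + ⌊ x /2⌋)
odd-half zero          = refl
odd-half (suc zero)    = refl
odd-half (suc (suc x)) with odd x | odd-half x
... | true  | e = cong (λ y → suc (suc y)) (trans e (sym (+-suc ⌊ x /2⌋ ⌊ x /2⌋)))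
... | false | e = cong suc (trans (cong suc e) (sym (+-suc ⌊ x /2⌋ ⌊ x /2⌋)))

half-< : ∀ {x y} → x < 2 * y → ⌊ x /2⌋ < y
half-< {x} {y} x<2y = ≰⇒> λ y≤h → <⇒≱ x<2y (begin
  2 * y                 ≡⟨ cong (y +_) (+-identityʳ y) ⟩
  y + y                 ≤⟨ +-mono-≤ y≤h y≤h ⟩
  ⌊ x /2⌋ + ⌊ x /2⌋     ≤⟨ m≤n+m _ (if odd x then 1 else 0) ⟩
  (if odd x then 1 else 0) + (⌊ x /2⌋ + ⌊ x /2⌋) ≡⟨ odd-half x ⟨
  x                     ∎)
  where open ≤-Reasoning

value-bits : ∀ w {x} → x < 2 ^ w → value (bits w x) ≡ x
value-bits zero    (s≤s z≤n) = refl
value-bits (suc w) {x} x<    =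
  trans (cong (λ h → (if odd x then 1 else 0) + (h + h)) (value-bits w (half-< x<)))
        (sym (odd-half x))

-- Turns agreement of adjacent nodes on every bit, one bit per phase, into equality of their roots.
bit-ext : ∀ b {x y} → x < 2 ^ b → y < 2 ^ b → (∀ j → j < b → bit j x ≡ bit j y) → x ≡ y
bit-ext zero    (s≤s z≤n) (s≤s z≤n) _ = refl
bit-ext (suc b) {x} {y} x< y< same = begin
  x                                                   ≡⟨ odd-half x ⟩
  (if odd x then 1 else 0) + (⌊ x /2⌋ + ⌊ x /2⌋)       ≡⟨ cong₂ (λ c h → (if c then 1 else 0) + (h + h)) (same 0 z<s)
                                                          (bit-ext b (half-< x<) (half-< y<) λ j j<b → same (suc j) (s<s j<b)) ⟩
  (if odd y then 1 else 0) + (⌊ y /2⌋ + ⌊ y /2⌋)       ≡⟨ odd-half y ⟨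
  y                                                   ∎
  where open ≡-Reasoning

-- Exponential growth of accepting trees

-- Bernoulli's inequality (1 + 1/K)^m ≥ 1 + m/K, multiplied by K^(m+1) to stay within the natural
-- numbers.
bernoulli : ∀ K m → K ^ m * (K + m) ≤ K * suc K ^ m
bernoulli K zero    = ≤-reflexive (solve 1 (λ K → con 1 :* (K :+ con 0) := K :* con 1) refl K)
  where open +-*-Solver
bernoulli K (suc m) = begin
  K * K ^ m * (K + suc m)                    ≤⟨ m≤m+n _ (K ^ m * m) ⟩
  K * K ^ m * (K + suc m) + K ^ m * m        ≡⟨ solve 3 (λ K m P → K :* P :* (K :+ (con 1 :+ m)) :+ P :* m :=
                                                  (con 1 :+ K) :* (P :* (K :+ m))) refl K m (K ^ m) ⟩
  suc K * (K ^ m * (K + m))                  ≤⟨ *-monoʳ-≤ (suc K) (bernoulli K m) ⟩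
  suc K * (K * suc K ^ m)                    ≡⟨ solve 2 (λ K Q → (con 1 :+ K) :* (K :* Q) :=
                                                  K :* ((con 1 :+ K) :* Q)) refl K (suc K ^ m) ⟩
  K * suc K ^ suc m                          ∎
  where
  open ≤-Reasoning
  open +-*-Solver

^-distribʳ-* : ∀ m a b → (a * b) ^ m ≡ a ^ m * b ^ m
^-distribʳ-* zero    a b = refl
^-distribʳ-* (suc m) a b = trans (cong (a * b *_) (^-distribʳ-* m a b))
  (solve 4 (λ a b c d → a :* b :* (c :* d) := a :* c :* (b :* d)) refl a b (a ^ m) (b ^ m))
  where open +-*-Solver

-- Bernoulli with m = K gives (1 + 1/K)^K ≥ 2. Hence `K * L` successive growths by the factor 1 +
-- 1/K amount to at least 2^L.
growth : ∀ K L .{{_ : NonZero K}} → K ^ (K * L) * 2 ^ L ≤ suc K ^ (K * L)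
growth K L = begin
  K ^ (K * L) * 2 ^ L     ≡⟨ cong (_* 2 ^ L) (^-*-assoc K K L) ⟨
  (K ^ K) ^ L * 2 ^ L     ≡⟨ ^-distribʳ-* L (K ^ K) 2 ⟨
  (K ^ K * 2) ^ L         ≤⟨ ^-monoˡ-≤ L doubling ⟩
  (suc K ^ K) ^ L         ≡⟨ ^-*-assoc (suc K) K L ⟩
  suc K ^ (K * L)         ∎
  where
  open ≤-Reasoning
  open +-*-Solver
  doubling : K ^ K * 2 ≤ suc K ^ K
  doubling = *-cancelˡ-≤ K (≤-trans
    (≤-reflexive (solve 2 (λ K P → K :* (P :* con 2) := P :* (K :+ K)) refl K (K ^ K)))
    (bernoulli K K))

n<2^suc⌊log₂n⌋ : ∀ n → n < 2 ^ suc ⌊log₂ n ⌋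
n<2^suc⌊log₂n⌋ n = ≰⇒> λ 2^≤n → <⇒≱ (n<1+n ⌊log₂ n ⌋)
  (subst (_≤ ⌊log₂ n ⌋) (⌊log₂[2^n]⌋≡n (suc ⌊log₂ n ⌋)) (⌊log₂⌋-mono-≤ 2^≤n))

-- The distributed algorithm

-- parent holds a port number, nothing at a terminal, and root the identifier of the terminal of
-- the tree; level is the distance to the terminals at the start of the current phase.
record Core : Set where
  field
    alive  : Bool
    root   : ℕ
    parent : Maybe ℕ
    level  : ℕ

-- target and accept are spread by a downcast: the future root, and whether its tree takes the nodes
-- that were attached to it.  token true and token false accumulate the numbers of red and of blue
-- nodes of a tree at its terminal.
record Node : Set where
  field
    core   : Core
    joined : Bool
    target : ℕ
    accept : Bool
    token  : Bool → ℕ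
  open Core core public

open Node

-- Only `up` transmits two different numbers; the other operations send the same number twice and
-- read `num m true`.
record Msg : Set where
  constructor msg
  field
    flag : Bool
    num  : Bool → ℕ

open Msg

-- The tasks of a round.  Phase i calls a tree red or blue according to bit i of its root.
data Op : Set where
  start bfs down up    : Op
  attach tally settle  : (i : ℕ) → Op
  decide               : (K : ℕ) → Op

red : ℕ → Node → Bool
red i s = bit i (root s)

message : Op → Node → ℕ → Msg
message start      s q = msg false (const 0)
message bfs        s q = msg (alive s ∧ joined s) (const (root s))
message (attach i) s q = msg (alive s) (const (root s))
message down       s q = msg (accept s) (const (target s))
message (tally i)  s q = msg false (const 0)
message up         s q = msg (alive s ∧ maybe (λ p → p ≡ᵇ q) false (parent s)) (token s)
message (decide K) s q = msg false (const 0)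
message (settle i) s q = msg false (const 0)

find : (Msg → Bool) → List Msg → Maybe (ℕ × Msg)
find P []       = nothing
find P (m ∷ ms) = if P m then just (0 , m) else Maybe.map (λ (q , m′) → suc q , m′) (find P ms)

at : List Msg → ℕ → Msg
at []       _       = msg false (const 0)
at (m ∷ ms) zero    = m
at (m ∷ ms) (suc q) = at ms q

-- A waiting node raises its level in every round, including the one in which it joins, so the final
-- level is the number of that round, which is the BFS distance.
adopt : Core → Maybe (ℕ × Msg) → Core
adopt c nothing        = record c { level = suc (Core.level c) }
adopt c (just (q , m)) = record c { root = num m true ; parent = just q ; level = suc (Core.level c) }

search : Node → List Msg → Maybe (ℕ × Msg)
search s ms = if alive s then find flag ms else nothing

redNeighbour : ℕ → Node → List Msg → Maybe (ℕ × Msg)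
redNeighbour i s ms =
  if alive s ∧ not (red i s) then find (λ m → flag m ∧ bit i (num m true)) ms else nothing

received : Bool → Msg → ℕ
received c m = if flag m then num m c else 0

update : Op → Node → List Msg → Node
update start s ms =
  -- With `accept = true` everywhere no tree counts as stalled at the start of a phase.
  record s { core = record (core s) { level = 0 } ; joined = is-nothing (parent s) ; accept = true }
update bfs s ms =
  record s { core   = if joined s then core s else adopt (core s) (search s ms)
           ; joined = joined s ∨ is-just (search s ms) }
-- Only the parent changes: root keeps the old tree until settle has decided the fate of the node.
update (attach i) s ms =
  record s { core = record (core s) { parent = maybe (just ∘ proj₁) (parent s) (redNeighbour i s ms) } }
update down s ms =
  record s { target = maybe (λ q → num (at ms q) true) (root s) (parent s)
           ; accept = maybe (λ q → flag (at ms q)) (accept s) (parent s) }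
update (tally i) s ms =
  record s { token = λ c → 𝟙 ((alive s ≟ᵇ true) ×-dec (red i s ≟ᵇ c)) }
update up s ms =
  record s { token = λ c → (if alive s ∧ is-just (parent s) then 0 else token s c)
                           + ListAction.sum (L.map (received c) ms) }
update (decide K) s ms =
  -- Every node evaluates this, but the downcast spreads only the value at terminals, where the
  -- tokens have gathered. A red tree without any offer rejects too, since its red count is
  -- positive.
  record s { accept = token s true ≤ᵇ K * token s false }
update (settle i) s ms =
  record s { core = record (core s)
    { alive = alive s ∧ (red i s ∨ (not (bit i (target s)) ∨ accept s)) ; root = target s } }

-- The last iteration is split off, so that `body` runs for 0, 1, 2, ... in this order and
-- invariants can be indexed by the number of completed iterations.
loop : ℕ → (ℕ → List Op) → List Op
loop zero    body = []
loop (suc m) body = loop m body ++ body m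

repeat : ℕ → Op → List Op
repeat m op = loop m λ _ → op ∷ []

-- `tally` comes after `attach` but still sees the old roots; an upcast along the new parents
-- therefore counts, separately, the old red nodes of a tree and the blue nodes offered to it.
stepOps : (R K i : ℕ) → List Op
stepOps R K i =
  attach i ∷ tally i ∷ repeat R up ++ decide K ∷ repeat R down ++ settle i ∷ []

phaseOps : (R S K i : ℕ) → List Op
phaseOps R S K i = start ∷ repeat R bfs ++ loop S λ _ → stepOps R K i

program : (R S K b : ℕ) → List Op
program R S K b = loop b (phaseOps R S K)

-- Messages as bit strings

encode : ℕ → Msg → List Bool
encode w m = flag m ∷ bits w (num m true) ++ bits w (num m false)

decode : ℕ → List Bool → Msg
decode w []       = msg false (const 0)
decode w (f ∷ cs) = msg f λ c → value (if c then L.take w cs else L.drop w cs)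

take-bits : ∀ w x cs → L.take w (bits w x ++ cs) ≡ bits w x
take-bits zero    x cs = refl
take-bits (suc w) x cs = cong (_ ∷_) (take-bits w _ cs)

drop-bits : ∀ w x cs → L.drop w (bits w x ++ cs) ≡ cs
drop-bits zero    x cs = refl
drop-bits (suc w) x cs = drop-bits w _ cs

num-decode-encode : ∀ w m c → num m c < 2 ^ w → num (decode w (encode w m)) c ≡ num m c
num-decode-encode w m true  small =
  trans (cong value (take-bits w (num m true) _)) (value-bits w small)
num-decode-encode w m false small =
  trans (cong value (drop-bits w (num m true) _)) (value-bits w small)

length-encode : ∀ w m → L.length (encode w m) ≡ suc (w + w)
length-encode w m = cong suc (trans (L.length-++ (bits w (num m true)))
  (cong₂ _+_ (length-bits w (num m true)) (length-bits w (num m false))))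

initial : ℕ → Node
initial ident = record
  { core   = record { alive = true ; root = ident ; parent = nothing ; level = 0 }
  ; joined = false ; target = 0 ; accept = false ; token = const 0 }

-- Synchronous execution of a list of operations

module Execution {n} (G : Network n) (w : ℕ) where
  open Network G

  -- Messages pass through the encoding, which keeps only `w` bits of a number; the correctness
  -- proof has to show that nothing it needs is lost.
  recv : Msg → Msg
  recv m = decode w (encode w m)

  Config : Set
  Config = Fin n → Node

  inbox : Op → Config → ∀ v → Fin (deg v) → Msg
  inbox op σ v p = recv (message op (σ (port v p)) (toℕ (back v p)))

  round : Op → Config → Config
  round op σ v = update op (σ v) (L.tabulate (inbox op σ v))

  exec : List Op → Config → Config
  exec ops σ = L.foldl (λ τ op → round op τ) σ ops

  exec-++ : ∀ ops ops′ σ → exec (ops ++ ops′) σ ≡ exec ops′ (exec ops σ)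
  exec-++ ops ops′ σ = L.foldl-++ (λ τ op → round op τ) σ ops ops′

  -- The rule for loop invariants. It is polymorphic in the universe level because the invariant of
  -- the upcast quantifies over classes of nodes.
  exec-loop : ∀ {ℓ body} (Inv : ℕ → Config → Set ℓ) m {σ} → Inv 0 σ →
              (∀ t τ → t < m → Inv t τ → Inv (suc t) (exec (body t) τ)) →
              Inv m (exec (loop m body) σ)
  exec-loop Inv zero    base next = base
  exec-loop {body = body} Inv (suc m) {σ} base next =
    subst (Inv (suc m)) (sym (exec-++ (loop m body) (body m) σ))
      (next m _ ≤-refl (exec-loop Inv m base λ t τ t<m → next t τ (m<n⇒m<1+n t<m)))

-- The CONGEST algorithm that runs a list of operations

module _ (width : ℕ → ℕ) (ops : ℕ → List Op) where

  -- Each node carries the operations still to be done. They depend on `N` only, so in every round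
  -- all nodes perform the same operation.
  algorithm : Algorithm
  algorithm = record
    { State  = List Op × Node
    ; init   = λ N ident _ → ops N , initial ident
    ; send   = send
    ; update = step′
    ; output = λ (_ , s) → alive s , root s
    ; rounds = λ N → L.length (ops N)
    }
    where
    send : ℕ → List Op × Node → ℕ → List Bool
    send N ([]     , s) q = []
    send N (op ∷ _ , s) q = encode (width N) (message op s q)
    step′ : ℕ → List Op × Node → List (List Bool) → List Op × Node
    step′ N ([]       , s) ms = [] , s
    step′ N (op ∷ ops , s) ms = ops , update op s (L.map (decode (width N)) ms)

  module _ {n} (cB N : ℕ) (G : Network n) (ident : Fin n → ℕ)
           (fits : suc (width N + width N) ≤ bandwidth cB N) where

    open Execution G (width N)

    private
      state : ℕ → Fin n → List Op × Node
      state = run algorithm cB N G ident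

    -- Every encoded message has `suc (w + w)` bits for `w = width N`, so by `fits` the bandwidth
    -- limit truncates nothing.
    run-step : ∀ {op todo σ} r → (∀ v → state r v ≡ (op ∷ todo , σ v)) →
               ∀ v → state (suc r) v ≡ (todo , round op σ v)
    run-step {op} {todo} {σ} r now v rewrite now v =
      cong (λ ms → todo , update op (σ v) ms) (trans (L.map-tabulate _ (decode (width N)))
        (L.tabulate-cong λ p → trans
          (cong (λ s → decode (width N) (L.take (bandwidth cB N) (Algorithm.send algorithm N s _))) (now _))
          (cong (decode (width N)) (L.take-all _ _
            (≤-trans (≤-reflexive (length-encode (width N) (message op (σ (Network.port G v p)) _))) fits)))))

    run-exec : ∀ todo r {σ} → (∀ v → state r v ≡ (todo , σ v)) →
               ∀ v → state (L.length todo + r) v ≡ ([] , exec todo σ v)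
    run-exec []          r now v = now v
    run-exec (op ∷ todo) r {σ} now v =
      subst (λ m → state m v ≡ ([] , exec todo (round op σ) v)) (+-suc (L.length todo) r)
        (run-exec todo (suc r) (run-step r now) v)

    result-exec : ∀ v → result algorithm cB N G ident v ≡
                  (alive (exec (ops N) (initial ∘ ident) v) , root (exec (ops N) (initial ∘ ident) v))
    result-exec v = cong (Algorithm.output algorithm)
      (subst (λ m → state m v ≡ ([] , exec (ops N) (initial ∘ ident) v)) (+-identityʳ (L.length (ops N)))
        (run-exec (ops N) 0 (λ _ → refl) v))

-- Tree sweeps

find-cases : ∀ {d} P (f : Fin d → Msg) →
             (∃[ p ] find P (L.tabulate f) ≡ just (toℕ p , f p) × P (f p) ≡ true)
             ⊎ (find P (L.tabulate f) ≡ nothing × ∀ p → P (f p) ≡ false)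
find-cases {zero}  P f = inj₂ (refl , λ ())
find-cases {suc d} P f with P (f zero) in eq
... | true  = inj₁ (zero , refl , eq)
... | false with find-cases P (f ∘ suc)
...   | inj₁ (p , found , holds) rewrite found = inj₁ (suc p , refl , holds)
...   | inj₂ (none , fails) rewrite none = inj₂ (refl , λ { zero → eq ; (suc p) → fails p })

at-tabulate : ∀ {d} (f : Fin d → Msg) p → at (L.tabulate f) (toℕ p) ≡ f p
at-tabulate f zero    = refl
at-tabulate f (suc p) = at-tabulate (f ∘ suc) p

≡ᵇ-refl : ∀ m → (m ≡ᵇ m) ≡ true
≡ᵇ-refl zero    = refl
≡ᵇ-refl (suc m) = ≡ᵇ-refl m

≡ᵇ-true : ∀ m {k} → (m ≡ᵇ k) ≡ true → m ≡ k
≡ᵇ-true zero    {zero}  _ = refl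
≡ᵇ-true (suc m) {suc k} e = cong suc (≡ᵇ-true m e)

module Sweeps {n} (G : Network n) (w : ℕ) where
  open Network G
  open Execution G w

  -- Chain A par v k r: following parents leads from v through A to the terminal r in k steps.
  data Chain (A : Fin n → Set) (par : Fin n → Maybe ℕ) : Fin n → ℕ → Fin n → Set where
    top  : ∀ {v} → A v → par v ≡ nothing → Chain A par v 0 v
    link : ∀ {v k r} → A v → ∀ p → par v ≡ just (toℕ p) → Chain A par (port v p) k r →
           Chain A par v (suc k) r

  module _ {A : Fin n → Set} {par : Fin n → Maybe ℕ} where

    chain-valid : ∀ {v k r} → Chain A par v k r → A v
    chain-valid (top a _)      = a
    chain-valid (link a _ _ _) = a

    chain-root : ∀ {v k r} → Chain A par v k r → Chain A par r 0 r
    chain-root c@(top _ _)    = c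
    chain-root (link _ _ _ c) = chain-root c

    chain-top : ∀ {v r} → Chain A par v 0 r → v ≡ r × par v ≡ nothing
    chain-top (top _ e) = refl , e

    chain-root-top : ∀ {v k r} → Chain A par v k r → par r ≡ nothing
    chain-root-top c = proj₂ (chain-top (chain-root c))

    -- A chain is determined by `par` alone, so the validity predicates may differ. Depths and
    -- terminals found in different ways are identified through this.
    chain-unique : ∀ {A′ v k k′ r r′} → Chain A par v k r → Chain A′ par v k′ r′ → k ≡ k′ × r ≡ r′
    chain-unique (top _ _)    (top _ _)     = refl , refl
    chain-unique (top _ e)    (link _ _ f _) with () ← trans (sym e) f
    chain-unique (link _ _ e _) (top _ f)    with () ← trans (sym e) f
    chain-unique (link _ p e c) (link _ q f d)
      with refl ← Fin.toℕ-injective (just-injective (trans (sym e) f))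
      with refl , refl ← chain-unique c d = refl , refl

    chain-parent : ∀ {v k r} p → par v ≡ just (toℕ p) → Chain A par v k r →
                   ∃[ k′ ] k ≡ suc k′ × Chain A par (port v p) k′ r
    chain-parent p e (top _ f) with () ← trans (sym e) f
    chain-parent p e (link _ q f c)
      with refl ← Fin.toℕ-injective (just-injective (trans (sym e) f)) = _ , refl , c

    chain-map : ∀ {A′ par′ v k r} → (∀ v → A v → A′ v × par′ v ≡ par v) →
                Chain A par v k r → Chain A′ par′ v k r
    chain-map f (top a e)      = top (proj₁ (f _ a)) (trans (proj₂ (f _ a)) e)
    chain-map f (link a p e c) = link (proj₁ (f _ a)) p (trans (proj₂ (f _ a)) e) (chain-map f c)

  Alive : Config → Fin n → Set
  Alive σ v = alive (σ v) ≡ true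

  Path : Config → Fin n → ℕ → Fin n → Set
  Path σ = Chain (Alive σ) (λ v → parent (σ v))

  _≈_ : Config → Config → Set
  τ ≈ σ = ∀ v → core (τ v) ≡ core (σ v)

  path-≈ : ∀ {σ τ v k r} → τ ≈ σ → Path σ v k r → Path τ v k r
  path-≈ τ≈σ = chain-map λ v a →
    trans (cong Core.alive (τ≈σ v)) a , cong Core.parent (τ≈σ v)

  record Downcast (σ : Config) (t : ℕ) (τ : Config) : Set where
    field
      core≈  : τ ≈ σ
      accept≡ : ∀ v → parent (σ v) ≡ nothing → accept (τ v) ≡ accept (σ v)
      -- A terminal needs one round to copy its own root into `target`, so `t` rounds serve exactly
      -- the depths below `t`.
      root≡  : ∀ {v k r} → k < t → Path σ v k r →
               target (τ v) ≡ root (σ r) × accept (τ v) ≡ accept (σ r)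

  downcast : ∀ m σ → (∀ v → Alive σ v → parent (σ v) ≡ nothing → root (σ v) < 2 ^ w) →
             Downcast σ m (exec (repeat m down) σ)
  downcast m σ small = exec-loop (Downcast σ) m
      (record { core≈ = λ _ → refl ; accept≡ = λ _ _ → refl ; root≡ = λ () })
      next
    where
    next : ∀ t τ → t < m → Downcast σ t τ → Downcast σ (suc t) (round down τ)
    next t τ _ inv = record
      { core≈ = core≈
      ; accept≡ = λ v e → trans (keep v e) (accept≡ v e)
      ; root≡ = received′ }
      where
      open Downcast inv
      par : ∀ {v x} → parent (σ v) ≡ x → parent (τ v) ≡ x
      par {v} e = trans (cong Core.parent (core≈ v)) e
      keep : ∀ v → parent (σ v) ≡ nothing → accept (round down τ v) ≡ accept (τ v)
      keep v e rewrite par {v} e = refl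
      received′ : ∀ {v k r} → k < suc t → Path σ v k r →
                  target (round down τ v) ≡ root (σ r) × accept (round down τ v) ≡ accept (σ r)
      received′ {v} _ (top a e) rewrite par {v} e = cong Core.root (core≈ v) , accept≡ v e
      received′ {v} {r = r} (s≤s k<t) (link a p e c)
        rewrite par {v} e | at-tabulate (inbox down τ v) p =
          trans (num-decode-encode w (message down (τ (port v p)) (toℕ (back v p))) true
                  (subst (_< 2 ^ w) (sym (proj₁ (root≡ k<t c)))
                    (small r (chain-valid (chain-root c)) (chain-root-top c))))
                (proj₁ (root≡ k<t c))
          , proj₂ (root≡ k<t c)

  module Upcast (σ : Config) (m : ℕ)
                (rooted : ∀ v → Alive σ v → ∃[ k ] ∃[ r ] Path σ v k r × k ≤ m)
                (small : ∀ c → sum (λ v → token (σ v) c) < 2 ^ w) where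

    -- In each round every node except a terminal pushes all its tokens to its parent.
    sent : Config → Bool → Fin n → ℕ → ℕ
    sent τ c u q = if flag (message up (τ u) q) then token (τ u) c else 0

    kept : Config → Bool → Fin n → ℕ
    kept τ c v = if alive (τ v) ∧ is-just (parent (τ v)) then 0 else token (τ v) c

    child : ∀ τ {u q} → flag (message up (τ u) q) ≡ true → Alive τ u × parent (τ u) ≡ just q
    child τ {u} {q} e with alive (τ u) | parent (τ u)
    ... | true | just p = refl , cong just (≡ᵇ-true p e)

    -- Closure of the class C under parents; the tokens of C then never leave C.
    Closed : (Fin n → Set) → Set
    Closed C = ∀ u p → Alive σ u → parent (σ u) ≡ just (toℕ p) →
               (C u → C (port u p)) × (C (port u p) → C u)

    record Inv (t : ℕ) (τ : Config) : Set₁ where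
      field
        core≈   : τ ≈ σ
        -- Used for two kinds of classes: all nodes, which bounds the size of the numbers sent, and
        -- the nodes of one tree, which identifies the final count at its terminal.
        total   : ∀ {C : Fin n → Set} (C? : Decidable C) → Closed C → ∀ c →
                  sum (λ v → 𝟙 (C? v) * token (τ v) c) ≡ sum (λ v → 𝟙 (C? v) * token (σ v) c)
        -- Depths greater than `m - t` are already empty; at `t = m` only terminals hold tokens
        -- among the alive nodes.
        drained : ∀ {v k r} c → m ≤ t + k → Path σ v (suc k) r → token (τ v) c ≡ 0

    module _ {t τ} (inv : Inv t τ) where
      open Inv inv

      -- Conservation for the class of all nodes bounds every single count by the initial total,
      -- which fits into `w` bits.
      token-small : ∀ c v → token (τ v) c < 2 ^ w
      token-small c v = ≤-<-trans (≤-sum (λ u → token (τ u) c) v) (subst (_< 2 ^ w) (sym conserved) (small c))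
        where
        all? : Decidable {A = Fin n} (λ _ → 0 ≡ 0)
        all? _ = yes refl
        conserved : sum (λ u → token (τ u) c) ≡ sum (λ u → token (σ u) c)
        conserved = trans (sum-cong-≗ {n} λ u → sym (+-identityʳ _))
          (trans (total all? (λ _ _ _ _ → (λ e → e) , λ e → e) c) (sum-cong-≗ {n} λ u → +-identityʳ _))

      received-sent : ∀ c v p → received c (inbox up τ v p) ≡ sent τ c (port v p) (toℕ (back v p))
      received-sent c v p = cong (λ x → if flag (message up (τ (port v p)) (toℕ (back v p))) then x else 0)
        (num-decode-encode w (message up (τ (port v p)) (toℕ (back v p))) c (token-small c (port v p)))

      token-next : ∀ c v → token (round up τ v) c ≡
                   kept τ c v + sum λ p → sent τ c (port v p) (toℕ (back v p))
      token-next c v = cong (kept τ c v +_)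
        (trans (sum-tabulate (received c) (inbox up τ v)) (sum-cong-≗ (received-sent c v)))

      par : ∀ {v x} → parent (σ v) ≡ x → parent (τ v) ≡ x
      par {v} e = trans (cong Core.parent (core≈ v)) e

      -- Tokens leave through the parent port only, so the sum has at most one nonzero term;
      -- terminals and dead nodes keep everything instead.
      token-split : ∀ c u → kept τ c u + sum {deg u} (λ q → sent τ c u (toℕ q)) ≡ token (τ u) c
      token-split c u with alive (σ u) in eqa
      ... | false rewrite trans (cong Core.alive (core≈ u)) eqa =
        trans (cong (token (τ u) c +_) (sum-replicate-zero (deg u))) (+-identityʳ _)
      ... | true with rooted u eqa
      ...   | _ , _ , top a e , _ rewrite trans (cong Core.alive (core≈ u)) eqa | par {u} e =
        trans (cong (token (τ u) c +_) (sum-replicate-zero (deg u))) (+-identityʳ _)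
      ...   | _ , _ , link a p e _ , _ rewrite trans (cong Core.alive (core≈ u)) eqa | par {u} e =
        trans (sum-single (λ q → if toℕ p ≡ᵇ toℕ q then token (τ u) c else 0) p λ q q≢p → other q q≢p)
              (cong (if_then token (τ u) c else 0) (≡ᵇ-refl (toℕ p)))
        where
        other : ∀ q → q ≢ p → (if toℕ p ≡ᵇ toℕ q then token (τ u) c else 0) ≡ 0
        other q q≢p with toℕ p ≡ᵇ toℕ q in eq
        ... | true  = ⊥-elim (q≢p (sym (Fin.toℕ-injective (≡ᵇ-true (toℕ p) eq))))
        ... | false = refl

      module _ {C : Fin n → Set} (C? : Decidable C) (closed : Closed C) (c : Bool) where

        -- A neighbour that sends tokens to `v` has `v` as its parent, so a closed class contains
        -- both or neither. This moves the indicator from the receiver to the sender.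
        same-class : ∀ v p → 𝟙 (C? v) * sent τ c (port v p) (toℕ (back v p)) ≡
                             𝟙 (C? (port v p)) * sent τ c (port v p) (toℕ (back v p))
        same-class v p with flag (message up (τ (port v p)) (toℕ (back v p))) in eq
        ... | false = trans (*-zeroʳ (𝟙 (C? v))) (sym (*-zeroʳ (𝟙 (C? (port v p)))))
        ... | true = cong (_* token (τ (port v p)) c)
          (≤-antisym (𝟙-mono (C? v) (C? (port v p)) (λ Cv → proj₂ iff (subst C (sym (port-back v p)) Cv)))
                     (𝟙-mono (C? (port v p)) (C? v) (λ Cu → subst C (port-back v p) (proj₁ iff Cu))))
          where
          facts = child τ {port v p} eq
          iff = closed (port v p) (back v p)
                  (trans (sym (cong Core.alive (core≈ (port v p)))) (proj₁ facts))
                  (trans (sym (cong Core.parent (core≈ (port v p)))) (proj₂ facts))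

        -- `token-next` adds up the transfers at the receivers, `token-split` at the senders;
        -- `handshake` equates the two sums over half-edges.
        conserve : sum (λ v → 𝟙 (C? v) * token (round up τ v) c) ≡ sum (λ v → 𝟙 (C? v) * token (τ v) c)
        conserve = begin
          sum (λ v → 𝟙 (C? v) * token (round up τ v) c)
            ≡⟨ sum-cong-≗ (λ v → trans (cong (𝟙 (C? v) *_) (token-next c v))
                 (trans (*-distribˡ-+ (𝟙 (C? v)) (kept τ c v) _)
                   (cong (𝟙 (C? v) * kept τ c v +_)
                     (trans (*-distribˡ-sum (𝟙 (C? v)) (λ p → sent τ c (port v p) (toℕ (back v p))))
                            (sum-cong-≗ (same-class v)))))) ⟩
          sum (λ v → 𝟙 (C? v) * kept τ c v + sum {deg v} (λ p → h (port v p) (toℕ (back v p))))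
            ≡⟨ ∑-distrib-+ (λ v → 𝟙 (C? v) * kept τ c v) _ ⟩
          sum (λ v → 𝟙 (C? v) * kept τ c v) + sum (λ v → sum {deg v} (λ p → h (port v p) (toℕ (back v p))))
            ≡⟨ cong (sum (λ v → 𝟙 (C? v) * kept τ c v) +_) (handshake G h) ⟩
          sum (λ v → 𝟙 (C? v) * kept τ c v) + sum (λ u → sum {deg u} (λ q → h u (toℕ q)))
            ≡⟨ ∑-distrib-+ (λ v → 𝟙 (C? v) * kept τ c v) _ ⟨
          sum (λ u → 𝟙 (C? u) * kept τ c u + sum {deg u} (λ q → h u (toℕ q)))
            ≡⟨ sum-cong-≗ (λ u → trans
                 (cong (𝟙 (C? u) * kept τ c u +_)
                   (sym (*-distribˡ-sum (𝟙 (C? u)) (λ (q : Fin (deg u)) → sent τ c u (toℕ q)))))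
                 (trans (sym (*-distribˡ-+ (𝟙 (C? u)) (kept τ c u) _)) (cong (𝟙 (C? u) *_) (token-split c u)))) ⟩
          sum (λ v → 𝟙 (C? v) * token (τ v) c) ∎
          where
          open ≡-Reasoning
          h : Fin n → ℕ → ℕ
          h u q = 𝟙 (C? u) * sent τ c u q

      next : Inv (suc t) (round up τ)
      next = record
        { core≈ = core≈
        ; total = λ C? closed c → trans (conserve C? closed c) (total C? closed c)
        ; drained = drained′ }
        where
        drained′ : ∀ {v k r} c → m ≤ suc t + k → Path σ v (suc k) r → token (round up τ v) c ≡ 0
        drained′ {v} {k} c m≤ path@(link a p e _) = trans (token-next c v) (cong₂ _+_ none (sum-zero nothing-sent))
          where
          none : kept τ c v ≡ 0
          none rewrite trans (cong Core.alive (core≈ v)) a | par {v} e = refl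
          nothing-sent : ∀ p → sent τ c (port v p) (toℕ (back v p)) ≡ 0
          nothing-sent p with flag (message up (τ (port v p)) (toℕ (back v p))) in eq
          ... | false = refl
          -- The sender is a child of `v`, one level deeper, and was therefore empty one round
          -- earlier.
          ... | true = drained c (subst (m ≤_) (sym (+-suc t k)) m≤)
            (link (trans (sym (cong Core.alive (core≈ (port v p)))) (proj₁ facts)) (back v p)
                  (trans (sym (cong Core.parent (core≈ (port v p)))) (proj₂ facts))
                  (subst (λ u → Path σ u (suc k) _) (sym (port-back v p)) path))
            where facts = child τ {port v p} eq

    upcast : Inv m (exec (repeat m up) σ)
    upcast = exec-loop Inv m base λ _ _ _ → next
      where
      base : Inv 0 σ
      base = record
        { core≈ = λ _ → refl
        ; total = λ _ _ _ → refl
        ; drained = λ {v} c m≤k path → ⊥-elim (deep v m≤k path) }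
        where
        deep : ∀ v {k r} → m ≤ k → Path σ v (suc k) r → _
        deep v m≤k path with rooted v (chain-valid path)
        ... | _ , _ , path′ , k′≤m with refl , _ ← chain-unique path path′ = <⇒≱ k′≤m m≤k

-- Here and in the next two lemmas the formula is the survival test of `settle`: `a` says that the
-- node was red, `b` that its new root is red, `c` that the tree accepts.
keeps-true : ∀ {a b c} → a ≡ true ⊎ (b ≡ false ⊎ c ≡ true) → a ∨ (not b ∨ c) ≡ true
keeps-true {true}                (inj₁ _)        = refl
keeps-true {true}                (inj₂ _)        = refl
keeps-true {false} {false}       (inj₂ _)        = refl
keeps-true {false} {true} {true} (inj₂ (inj₂ _)) = refl

true-keeps : ∀ {a b c} → a ∨ (not b ∨ c) ≡ true → a ≡ true ⊎ (b ≡ false ⊎ c ≡ true)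
true-keeps {true}                _ = inj₁ refl
true-keeps {false} {false}       _ = inj₂ (inj₁ refl)
true-keeps {false} {true} {true} _ = inj₂ (inj₂ refl)

¬keeps : ∀ {a b c} → a ∨ (not b ∨ c) ≢ true → a ≡ false × b ≡ true × c ≡ false
¬keeps {true}                 ¬k = ⊥-elim (¬k refl)
¬keeps {false} {false}        ¬k = ⊥-elim (¬k refl)
¬keeps {false} {true} {true}  ¬k = ⊥-elim (¬k refl)
¬keeps {false} {true} {false} ¬k = refl , refl , refl

-- Phases and steps

module Clustering {n} (G : Network n) (w : ℕ) (ident : Fin n → ℕ) (ident-inj : Injective _≡_ _≡_ ident)
               (ident< : ∀ v → ident v < 2 ^ w) (n<2^w : n < 2 ^ w) (K : ℕ) where
  open Network G
  open Execution G w
  open Sweeps G w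

  alive? : ∀ σ → Decidable (Alive σ)
  alive? σ v = alive (σ v) ≟ᵇ true

  record Rooted (σ : Config) (v : Fin n) (bound : ℕ) : Set where
    constructor rooted-at
    field
      {depth} : ℕ
      apex    : Fin n
      path    : Path σ v depth apex
      depth≤  : depth ≤ bound
      root≡   : root (σ v) ≡ ident apex

  Separated : ℕ → Config → Set
  Separated i σ = ∀ v p → Alive σ v → Alive σ (port v p) →
                  ∀ j → j < i → bit j (root (σ v)) ≡ bit j (root (σ (port v p)))

  -- A red tree whose last decision was to reject has no blue neighbours left, and stays so
  -- until the end of the phase.
  Stalled : ℕ → Config → Fin n → Set
  Stalled i σ v = Alive σ v × red i (σ v) ≡ true × accept (σ v) ≡ false

  stalled? : ∀ i σ → Decidable (Stalled i σ)
  stalled? i σ v = alive? σ v ×-dec ((red i (σ v) ≟ᵇ true) ×-dec (accept (σ v) ≟ᵇ false))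

  Member : Config → Fin n → Fin n → Set
  Member σ r v = Alive σ v × root (σ v) ≡ ident r

  member? : ∀ σ r → Decidable (Member σ r)
  member? σ r v = alive? σ v ×-dec (root (σ v) ≟ ident r)

  record Between (i D : ℕ) (σ : Config) : Set where
    field
      rooted    : ∀ v → Alive σ v → Rooted σ v D
      separated : Separated i σ
      -- At most n/K nodes are lost in each of the `i` phases so far, with the denominator cleared.
      survivors : K * n ≤ K * # (alive? σ) + i * n

  -- After t steps of phase i; A₀ nodes were alive at its start.  In deaths, the nodes removed so far
  -- are charged to the trees that rejected them: a tree rejects only once with a nonempty offer.
  record Within (A₀ i D t : ℕ) (σ : Config) : Set where
    field
      rooted    : ∀ v → Alive σ v → Rooted σ v (level (σ v) + 2 * t)
      uniform   : ∀ {v k r} → Path σ v k r → accept (σ v) ≡ accept (σ r)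
      shallow   : ∀ v → Alive σ v → level (σ v) ≤ D
      smooth    : ∀ v p → Alive σ v → Alive σ (port v p) → level (σ (port v p)) ≤ suc (level (σ v))
      -- A node that is still blue has kept its BFS parent during this phase. Links made by
      -- attachments need not decrease the level.
      blue-link : ∀ v p → Alive σ v → red i (σ v) ≡ false → parent (σ v) ≡ just (toℕ p) →
                  suc (level (σ (port v p))) ≤ level (σ v)
      separated : Separated i σ
      stalled   : ∀ v p → Stalled i σ v → Alive σ (port v p) → red i (σ (port v p)) ≡ true
      -- Size at least (1 + 1/K)^t, with the denominator cleared.
      grown     : ∀ r → Alive σ r → parent (σ r) ≡ nothing → red i (σ r) ≡ true → accept (σ r) ≡ true →
                  suc K ^ t ≤ K ^ t * # (member? σ r)
      deaths    : K * A₀ ≤ K * # (alive? σ) + # (stalled? i σ)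

  -- Rebuilding the forest by breadth-first search

  module Bfs {i D : ℕ} {σ : Config} (before : Between i D σ) where
    open Between before

    Joined : Config → Fin n → Set
    Joined τ v = Alive τ v × joined (τ v) ≡ true

    data BfsRound (τ : Config) (v : Fin n) : Set where
      stays : joined (τ v) ≡ true → core (round bfs τ v) ≡ core (τ v) →
              joined (round bfs τ v) ≡ true → BfsRound τ v
      joins : joined (τ v) ≡ false → ∀ p → Joined τ (port v p) →
              core (round bfs τ v) ≡ adopt (core (τ v)) (just (toℕ p , inbox bfs τ v p)) →
              joined (round bfs τ v) ≡ true → BfsRound τ v
      waits : joined (τ v) ≡ false → (∀ p → ¬ Joined τ (port v p)) →
              core (round bfs τ v) ≡ adopt (core (τ v)) nothing →
              joined (round bfs τ v) ≡ false → BfsRound τ v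

    bfs-round : ∀ τ v → Alive τ v → BfsRound τ v
    bfs-round τ v a with joined (τ v) in eqj | find-cases flag (inbox bfs τ v)
    ... | true  | _ = stays eqj
                    (cong (λ b → if b then core (τ v) else adopt (core (τ v)) (search (τ v) (L.tabulate (inbox bfs τ v)))) eqj)
                    (cong (_∨ is-just (search (τ v) (L.tabulate (inbox bfs τ v)))) eqj)
    ... | false | inj₁ (p , found , flagged) = joins eqj p neighbour core≡
                    (cong₂ (λ b x → b ∨ is-just x) eqj search≡)
      where
      search≡ : search (τ v) (L.tabulate (inbox bfs τ v)) ≡ just (toℕ p , inbox bfs τ v p)
      search≡ = trans (cong (λ b → if b then find flag (L.tabulate (inbox bfs τ v)) else nothing) a) found
      core≡ = cong₂ (λ b x → if b then core (τ v) else adopt (core (τ v)) x) eqj search≡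
      neighbour : Joined τ (port v p)
      neighbour with alive (τ (port v p)) | joined (τ (port v p))
      ... | true | true = refl , refl
    ... | false | inj₂ (none , unflagged) = waits eqj alone core≡
                    (cong₂ (λ b x → b ∨ is-just x) eqj search≡)
      where
      search≡ : search (τ v) (L.tabulate (inbox bfs τ v)) ≡ nothing
      search≡ = trans (cong (λ b → if b then find flag (L.tabulate (inbox bfs τ v)) else nothing) a) none
      core≡ = cong₂ (λ b x → if b then core (τ v) else adopt (core (τ v)) x) eqj search≡
      alone : ∀ p → ¬ Joined τ (port v p)
      alone p (a′ , j′) with () ← trans (sym (unflagged p)) (cong₂ _∧_ a′ j′)

    bfs-alive : ∀ τ v → alive (round bfs τ v) ≡ alive (τ v)
    bfs-alive τ v with joined (τ v) | search (τ v) (L.tabulate (inbox bfs τ v))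
    ... | true  | _       = refl
    ... | false | nothing = refl
    ... | false | just _  = refl

    -- The paths of the old forest consist of alive nodes, so a node of old depth `k` joins within
    -- `k` rounds (`covered`). New levels thus never exceed old depths, and the bound `D` survives
    -- the rebuilding.
    record Inv (t : ℕ) (τ : Config) : Set where
      field
        alive≡  : ∀ v → alive (τ v) ≡ alive (σ v)
        accept≡ : ∀ v → accept (τ v) ≡ true
        waiting : ∀ v → Alive τ v → joined (τ v) ≡ false → level (τ v) ≡ t
        level≤t : ∀ v → Joined τ v → level (τ v) ≤ t
        low     : ∀ v → Alive τ v → ∀ j → j < i → bit j (root (τ v)) ≡ bit j (root (σ v))
        tree    : ∀ v → Joined τ v → ∃[ r ]
                  Chain (Joined τ) (λ u → parent (τ u)) v (level (τ v)) r × root (τ v) ≡ ident r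
        covered : ∀ {v k r} → Path σ v k r → k ≤ t → joined (τ v) ≡ true
        level≤  : ∀ {v k r} → Path σ v k r → joined (τ v) ≡ true → level (τ v) ≤ k
        -- The first alternative is for nodes that joined in the latest round, which their
        -- neighbours have not yet heard of.
        smooth  : ∀ v p → Joined τ v → Alive τ (port v p) →
                  level (τ v) ≡ t ⊎ (joined (τ (port v p)) ≡ true × level (τ (port v p)) ≤ suc (level (τ v)))

    base : Inv 0 (round start σ)
    base = record
      { alive≡  = λ _ → refl
      ; accept≡ = λ _ → refl
      ; waiting = λ _ _ _ → refl
      ; level≤t = λ _ _ → z≤n
      ; low     = λ _ _ _ _ → refl
      ; tree    = tree
      ; covered = λ { (top _ e) _ → cong is-nothing e }
      ; level≤  = λ _ _ → z≤n
      ; smooth  = λ _ _ _ _ → inj₁ refl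
      }
      where
      is-top : ∀ {v} → is-nothing (parent (σ v)) ≡ true → parent (σ v) ≡ nothing
      is-top {v} e with parent (σ v)
      ... | nothing = refl
      tree : ∀ v → Joined (round start σ) v → _
      tree v (a , j) with rooted v a
      ... | rooted-at r path _ root≡
        with refl , refl ← chain-unique path (top {A = Alive σ} {par = λ u → parent (σ u)} a (is-top j)) =
        v , top (a , j) (is-top j) , root≡

    module _ {t τ} (inv : Inv t τ) where
      open Inv inv

      private
        τ′ = round bfs τ

      alive← : ∀ {v} → Alive τ′ v → Alive τ v
      alive← {v} a = trans (sym (bfs-alive τ v)) a

      alive→ : ∀ {v} → Alive τ v → Alive τ′ v
      alive→ {v} a = trans (bfs-alive τ v) a

      kept : ∀ {v} → Joined τ v → core (τ′ v) ≡ core (τ v) × joined (τ′ v) ≡ true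
      kept {v} (a , j) with bfs-round τ v a
      ... | stays _ e j′   = e , j′
      ... | joins j′ _ _ _ _ with () ← trans (sym j) j′
      kept {v} (a , j) | waits j′ _ _ _ with () ← trans (sym j) j′

      kept-chain : ∀ {v k r} → Chain (Joined τ) (λ u → parent (τ u)) v k r →
                   Chain (Joined τ′) (λ u → parent (τ′ u)) v k r
      kept-chain = chain-map λ v jv → (alive→ (proj₁ jv) , proj₂ (kept jv)) , cong Core.parent (proj₁ (kept jv))

      adopted : ∀ {v p} → Joined τ (port v p) → num (inbox bfs τ v p) true ≡ root (τ (port v p))
      adopted {v} {p} j = num-decode-encode w (message bfs (τ (port v p)) (toℕ (back v p))) true
        (subst (_< 2 ^ w) (sym (proj₂ (proj₂ (tree (port v p) j)))) (ident< _))

      next : Inv (suc t) τ′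
      next = record
        { alive≡  = λ v → trans (bfs-alive τ v) (alive≡ v)
        ; accept≡ = accept≡
        ; waiting = waiting′
        ; level≤t = level≤t′
        ; low     = low′
        ; tree    = tree′
        ; covered = covered′
        ; level≤  = level≤′
        ; smooth  = smooth′
        }
        where
        waiting′ : ∀ v → Alive τ′ v → joined (τ′ v) ≡ false → level (τ′ v) ≡ suc t
        waiting′ v a′ j′ with bfs-round τ v (alive← a′)
        ... | stays _ _ j with () ← trans (sym j′) j
        ... | joins _ _ _ _ j with () ← trans (sym j′) j
        ... | waits j _ e _ = trans (cong Core.level e) (cong suc (waiting v (alive← a′) j))

        level≤t′ : ∀ v → Joined τ′ v → level (τ′ v) ≤ suc t
        level≤t′ v (a′ , j′) with bfs-round τ v (alive← a′)
        ... | stays j e _ = ≤-trans (≤-reflexive (cong Core.level e)) (m≤n⇒m≤1+n (level≤t v (alive← a′ , j)))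
        ... | joins j _ _ e _ = ≤-reflexive (trans (cong Core.level e) (cong suc (waiting v (alive← a′) j)))
        ... | waits _ _ _ j with () ← trans (sym j′) j

        low′ : ∀ v → Alive τ′ v → ∀ j → j < i → bit j (root (τ′ v)) ≡ bit j (root (σ v))
        low′ v a′ j j<i with bfs-round τ v (alive← a′)
        ... | stays _ e _ = trans (cong (bit j ∘ Core.root) e) (low v (alive← a′) j j<i)
        ... | waits _ _ e _ = trans (cong (bit j ∘ Core.root) e) (low v (alive← a′) j j<i)
        -- The node may change to another tree, but it adopts the root of an alive neighbour, and
        -- `separated` makes the two agree on the bits below `i`.
        ... | joins _ p ju e _ = trans (cong (bit j) (trans (cong Core.root e) (adopted {v} {p} ju)))
          (trans (low (port v p) (proj₁ ju) j j<i)
            (sym (separated v p (trans (sym (alive≡ v)) (alive← a′))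
                   (trans (sym (alive≡ (port v p))) (proj₁ ju)) j j<i)))

        tree′ : ∀ v → Joined τ′ v → ∃[ r ]
                Chain (Joined τ′) (λ u → parent (τ′ u)) v (level (τ′ v)) r × root (τ′ v) ≡ ident r
        tree′ v (a′ , j′) with bfs-round τ v (alive← a′)
        ... | waits _ _ _ j with () ← trans (sym j′) j
        ... | stays j e _ with tree v (alive← a′ , j)
        ...   | r , c , root≡ = r , subst (λ k → Chain _ _ v k r) (sym (cong Core.level e)) (kept-chain c)
                                  , trans (cong Core.root e) root≡
        tree′ v (a′ , j′) | joins j p ju e _ with tree (port v p) ju
        ... | r , c , root≡ = r , subst (λ k → Chain _ _ v k r) level≡ (link (a′ , j′) p (cong Core.parent e) (kept-chain c))
                            , trans (cong Core.root e) (trans (adopted {v} {p} ju) root≡)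
          where
          -- The neighbour must have joined in the latest round; otherwise `v` would have joined
          -- before.
          level≡ : suc (level (τ (port v p))) ≡ level (τ′ v)
          level≡ with smooth (port v p) (back v p) ju (subst (Alive τ) (sym (port-back v p)) (alive← a′))
          ... | inj₁ last = trans (cong suc (trans last (sym (waiting v (alive← a′) j)))) (sym (cong Core.level e))
          ... | inj₂ (jv , _) with () ← trans (sym j) (subst (λ u → joined (τ u) ≡ true) (port-back v p) jv)

        covered′ : ∀ {v k r} → Path σ v k r → k ≤ suc t → joined (τ′ v) ≡ true
        covered′ {v} (top a e) _ = proj₂ (kept (trans (alive≡ v) a , covered (top a e) z≤n))
        covered′ {v} (link a p e c) (s≤s k≤t) with bfs-round τ v (trans (alive≡ v) a)
        ... | stays _ _ j = j
        ... | joins _ _ _ _ j = j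
        ... | waits _ alone _ _ = ⊥-elim (alone p (trans (alive≡ (port v p)) (chain-valid c) , covered c k≤t))

        level≤′ : ∀ {v k r} → Path σ v k r → joined (τ′ v) ≡ true → level (τ′ v) ≤ k
        level≤′ {v} {k} c j′ with bfs-round τ v (trans (alive≡ v) (chain-valid c))
        ... | stays j e _ = ≤-trans (≤-reflexive (cong Core.level e)) (level≤ c j)
        ... | waits _ _ _ j with () ← trans (sym j′) j
        level≤′ {v} {k} c j′ | joins j p ju e _ = ≤-trans
          (≤-reflexive (trans (cong Core.level e) (cong suc (waiting v (trans (alive≡ v) (chain-valid c)) j))))
          (≰⇒> λ k≤t → contradiction (trans (sym j) (covered c k≤t)) λ ())

        smooth′ : ∀ v p → Joined τ′ v → Alive τ′ (port v p) →
                  level (τ′ v) ≡ suc t ⊎ (joined (τ′ (port v p)) ≡ true × level (τ′ (port v p)) ≤ suc (level (τ′ v)))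
        smooth′ v p (a′ , j′) b′ with bfs-round τ v (alive← a′)
        ... | waits _ _ _ j with () ← trans (sym j′) j
        ... | joins j _ _ e _ = inj₁ (trans (cong Core.level e) (cong suc (waiting v (alive← a′) j)))
        ... | stays j e _ with smooth v p (alive← a′ , j) (alive← b′)
        ...   | inj₂ (ju , close) = inj₂ (proj₂ (kept jo) ,
                  subst₂ _≤_ (sym (cong Core.level (proj₁ (kept jo)))) (cong suc (sym (cong Core.level e))) close)
          where jo = alive← b′ , ju
        ...   | inj₁ last with bfs-round τ (port v p) (alive← b′)
        ...     | stays ju e′ j″ = inj₂ (j″ , ≤-trans (≤-reflexive (cong Core.level e′))
                    (≤-trans (level≤t _ (alive← b′ , ju)) (≤-trans (≤-reflexive (sym (trans (cong Core.level e) last))) (n≤1+n _))))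
        ...     | joins ju q _ e′ j″ = inj₂ (j″ , ≤-reflexive (trans (cong Core.level e′)
                    (cong suc (trans (waiting _ (alive← b′) ju) (sym (trans (cong Core.level e) last))))))
        ...     | waits _ alone _ _ = ⊥-elim (alone (back v p)
                    (subst (Joined τ) (sym (port-back v p)) (alive← a′ , j)))

    grow : ∀ m → D < m → Within (# (alive? σ)) i D 0 (exec (repeat m bfs) (round start σ))
    grow m D<m = record
      { rooted    = λ v a → let r , c , root≡ = tree v (full a)
                            in rooted-at r (path c) (m≤m+n _ _) root≡
      ; uniform   = λ _ → trans (accept≡ _) (sym (accept≡ _))
      ; shallow   = λ v a → shallow a
      ; smooth    = smooth-all
      ; blue-link = blue-link
      ; separated = λ v p a b j j<i → trans (low v a j j<i)
          (trans (separated v p (old a) (old b) j j<i) (sym (low (port v p) b j j<i)))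
      ; stalled   = λ v p (_ , _ , acc) _ → ⊥-elim (accepting v acc)
      ; grown     = λ r a e _ _ → ≤-trans (#-pos (member? τ r) r (a , own a e)) (≤-reflexive (sym (+-identityʳ _)))
      ; deaths    = ≤-trans (*-monoʳ-≤ K (#-mono (alive? σ) (alive? τ) λ v a → trans (alive≡ v) a)) (m≤m+n _ _)
      }
      where
      τ = exec (repeat m bfs) (round start σ)
      inv : Inv m τ
      inv = exec-loop Inv m base λ _ _ _ → next
      open Inv inv
      accepting : ∀ v → accept (τ v) ≢ false
      accepting v acc with () ← trans (sym acc) (accept≡ v)
      old : ∀ {v} → Alive τ v → Alive σ v
      old {v} a = trans (sym (alive≡ v)) a
      full : ∀ {v} → Alive τ v → Joined τ v
      full {v} a with rooted v (old a)
      ... | rooted-at _ p k≤D _ = a , covered p (≤-trans k≤D (<⇒≤ D<m))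
      path : ∀ {v k r} → Chain (Joined τ) (λ u → parent (τ u)) v k r → Path τ v k r
      path = chain-map λ v jv → proj₁ jv , refl
      shallow : ∀ {v} → Alive τ v → level (τ v) ≤ D
      shallow {v} a with rooted v (old a)
      ... | rooted-at _ p k≤D _ = ≤-trans (level≤ p (proj₂ (full a))) k≤D
      smooth-all : ∀ v p → Alive τ v → Alive τ (port v p) → level (τ (port v p)) ≤ suc (level (τ v))
      smooth-all v p a b with smooth v p (full a) b
      ... | inj₂ (_ , close) = close
      -- Levels are at most `D < m`, so nobody joined in the last round.
      ... | inj₁ last = ⊥-elim (<⇒≱ D<m (subst (_≤ D) last (shallow a)))
      blue-link : ∀ v p → Alive τ v → _ → parent (τ v) ≡ just (toℕ p) → suc (level (τ (port v p))) ≤ level (τ v)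
      blue-link v p a _ e with tree v (full a)
      ... | r , c , _ with chain-parent p e c
      ...   | k , level≡ , c′ with tree (port v p) (chain-valid c′)
      ...     | _ , c″ , _ with refl , _ ← chain-unique c′ c″ = ≤-reflexive (sym level≡)
      own : ∀ {r} → Alive τ r → parent (τ r) ≡ nothing → root (τ r) ≡ ident r
      own {r} a e with tree r (full a)
      ... | _ , c , root≡
        with _ , refl ← chain-unique c (top {A = Alive τ} {par = λ u → parent (τ u)} a e) = root≡

  -- One step of a phase: attachments

  module Step {A₀ i D t : ℕ} {σ : Config} (within : Within A₀ i D t σ) (m : ℕ) (deep : D + 2 * suc t < m) where
    open Within within

    Red : Fin n → Set
    Red v = red i (σ v) ≡ true

    Blue : Fin n → Set
    Blue v = red i (σ v) ≡ false

    ¬both : ∀ {b} → b ≡ true → b ≡ false → ∀ {A : Set} → A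
    ¬both refl ()

    σ₁ σ₂ : Config
    σ₁ = round (attach i) σ
    σ₂ = round (tally i) σ₁

    root-path : ∀ {v k r} → Path σ v k r → root (σ v) ≡ ident r
    root-path {v} path with rooted v (chain-valid path)
    ... | rooted-at _ path′ _ root≡ with _ , refl ← chain-unique path path′ = root≡

    path-root : ∀ {v r} → Alive σ v → root (σ v) ≡ ident r → ∃[ k ] Path σ v k r
    path-root {v} a root≡ with rooted v a
    ... | rooted-at r path _ root≡′ with refl ← ident-inj (trans (sym root≡) root≡′) = _ , path

    red-root : ∀ {v r} b → root (σ v) ≡ ident r → red i (σ v) ≡ b → bit i (ident r) ≡ b
    red-root b root≡ colour = trans (cong (bit i) (sym root≡)) colour

    red-parent : ∀ {v} p {b} → Alive σ v → parent (σ v) ≡ just (toℕ p) → red i (σ v) ≡ b →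
                 red i (σ (port v p)) ≡ b
    red-parent {v} p {b} a e colour with rooted v a
    ... | rooted-at r path _ root≡ with chain-parent p e path
    ...   | _ , _ , path′ = trans (cong (bit i) (root-path path′)) (red-root b root≡ colour)

    data AttachRound (v : Fin n) : Set where
      red-stays  : Red v → parent (σ₁ v) ≡ parent (σ v) → AttachRound v
      moves      : Blue v → ∀ p → Alive σ (port v p) → Red (port v p) →
                   parent (σ₁ v) ≡ just (toℕ p) → AttachRound v
      blue-stays : Blue v → (∀ p → Alive σ (port v p) → Blue (port v p)) →
                   parent (σ₁ v) ≡ parent (σ v) → AttachRound v

    searching : Fin n → Bool → Bool → Maybe (ℕ × Msg)
    searching v a b = if a ∧ not b
      then find (λ m → flag m ∧ bit i (num m true)) (L.tabulate (inbox (attach i) σ v)) else nothing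

    attach-round : ∀ v → Alive σ v → AttachRound v
    attach-round v a with red i (σ v) in eqr | find-cases (λ m → flag m ∧ bit i (num m true)) (inbox (attach i) σ v)
    ... | true  | _     = red-stays eqr (cong (maybe (just ∘ proj₁) (parent (σ v))) (cong₂ (searching v) a eqr))
    ... | false | found = decide-by found
      where
      search≡ : searching v (alive (σ v)) (red i (σ v)) ≡ searching v true false
      search≡ = cong₂ (searching v) a eqr
      heard : ∀ p → Alive σ (port v p) → num (inbox (attach i) σ v p) true ≡ root (σ (port v p))
      heard p b = num-decode-encode w (message (attach i) (σ (port v p)) (toℕ (back v p))) true
        (subst (_< 2 ^ w) (sym (Rooted.root≡ (rooted _ b))) (ident< _))
      decide-by : _ → AttachRound v
      decide-by (inj₁ (p , found , holds)) = moves eqr p alive-p red-p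
          (cong (maybe (just ∘ proj₁) (parent (σ v))) (trans search≡ found))
        where
        alive-p : Alive σ (port v p)
        alive-p = ∧-conicalˡ _ _ holds
        red-p : Red (port v p)
        red-p = trans (cong (bit i) (sym (heard p alive-p)))
          (trans (cong (_∧ bit i (num (inbox (attach i) σ v p) true)) (sym alive-p)) holds)
      decide-by (inj₂ (none , fails)) = blue-stays eqr
        (λ p b → trans (cong (bit i) (sym (heard p b)))
          (trans (cong (_∧ bit i (num (inbox (attach i) σ v p) true)) (sym b)) (fails p)))
        (cong (maybe (just ∘ proj₁) (parent (σ v))) (trans search≡ none))

    -- How v comes to be in the tree of r once all attachments are made: it was red already, it
    -- follows an ancestor z that has attached itself to the red neighbour behind port q, or no
    -- ancestor has moved.
    data Fate (v r : Fin n) : Set where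
      already : Red v → root (σ v) ≡ ident r → Fate v r
      moved   : Blue v → ∀ z q → Alive σ z → Blue z → Alive σ (port z q) → Red (port z q) →
                root (σ (port z q)) ≡ ident r → Fate v r
      unmoved : Blue v → (∀ p → Alive σ (port v p) → Blue (port v p)) → root (σ v) ≡ ident r →
                parent (σ₁ v) ≡ parent (σ v) → Fate v r

    record Merged (v : Fin n) : Set where
      constructor merged
      field
        {depth} : ℕ
        apex    : Fin n
        path    : Path σ₁ v depth apex
        depth≤  : depth ≤ level (σ v) + 2 * suc t
        fate    : Fate v apex
        low     : ∀ j → j < i → bit j (ident apex) ≡ bit j (root (σ v))

    red-path : ∀ {v k r} → Path σ v k r → Red v → Path σ₁ v k r
    red-path {v} path colour with attach-round v (chain-valid path)
    ... | moves blue _ _ _ _ = ¬both colour blue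
    ... | blue-stays blue _ _ = ¬both colour blue
    red-path (top a e) colour | red-stays _ e₁ = top a (trans e₁ e)
    red-path (link a p e c) colour | red-stays _ e₁ =
      link a p (trans e₁ e) (red-path c (red-parent p a e colour))

    -- Induction along the old path; no cycle arises, since blue nodes attach to red ones and red
    -- ones never move. A moving node gets depth at most 1 + (level + 1) + 2t, which is level + 2(t
    -- + 1). For a blue node that stays, the depth exceeds that of its parent by one, and by
    -- `blue-link` so does the level at least.
    merge : ∀ {v k r} → Path σ v k r → Merged v
    merge {v} path with attach-round v (chain-valid path)
    merge {v} path | red-stays colour _ with rooted v (chain-valid path)
    ... | rooted-at r path′ k≤ root≡ = merged r (red-path path′ colour)
          (≤-trans k≤ (+-monoʳ-≤ (level (σ v)) (*-monoʳ-≤ 2 (n≤1+n t)))) (already colour root≡)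
          λ j _ → cong (bit j) (sym root≡)
    merge {v} path | moves colour p a′ red′ e with rooted (port v p) a′
    ... | rooted-at r path′ k≤ root≡ = merged r (link (chain-valid path) p e (red-path path′ red′))
          (begin
            suc _                                  ≤⟨ s≤s k≤ ⟩
            suc (level (σ (port v p)) + 2 * t)     ≤⟨ s≤s (+-monoˡ-≤ (2 * t) (smooth v p (chain-valid path) a′)) ⟩
            suc (suc (level (σ v)) + 2 * t)        ≡⟨ solve 2 (λ l t → con 1 :+ (con 1 :+ l :+ con 2 :* t) :=
                                                        l :+ con 2 :* (con 1 :+ t)) refl (level (σ v)) t ⟩
            level (σ v) + 2 * suc t                ∎)
          (moved colour v p (chain-valid path) colour a′ red′ root≡)
          λ j j<i → trans (cong (bit j) (sym root≡)) (sym (separated v p (chain-valid path) a′ j j<i))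
      where
      open ≤-Reasoning
      open +-*-Solver
    merge {v} path@(top a e) | blue-stays colour blues e₁ =
      merged v (top a (trans e₁ e)) z≤n (unmoved colour blues (root-path path) e₁)
        λ j _ → cong (bit j) (sym (root-path path))
    merge {v} path@(link a p e c) | blue-stays colour blues e₁ with merge c
    ... | merged r path′ k≤ fate low = merged r (link a p (trans e₁ e) path′)
          (≤-trans (s≤s k≤) (+-monoˡ-≤ (2 * suc t) (blue-link v p a colour e)))
          (inherit fate)
          λ j j<i → trans (low j j<i) (cong (bit j) (trans (root-path c) (sym (root-path path))))
      where
      inherit : ∀ {r} → Fate (port v p) r → Fate v r
      inherit (already red′ _) = ¬both red′ (red-parent p a e colour)
      inherit (moved _ z q a b c d root≡) = moved colour z q a b c d root≡
      inherit (unmoved _ _ root≡ _) =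
        unmoved colour blues (trans (trans (root-path path) (sym (root-path c))) root≡) e₁

    merging : ∀ v → Alive σ v → Merged v
    merging v a = merge (Rooted.path (rooted v a))

    fate : ∀ {v k r} → Path σ₁ v k r → Fate v r
    fate {v} path with merging v (chain-valid path)
    ... | merged r path′ _ f _ with _ , refl ← chain-unique path path′ = f

    depth< : ∀ {v k r} → Path σ₁ v k r → k < m
    depth< {v} path with merging v (chain-valid path)
    ... | merged r path′ k≤ _ _ with refl , _ ← chain-unique path path′ =
      ≤-<-trans (≤-trans k≤ (+-monoˡ-≤ (2 * suc t) (shallow v (chain-valid path)))) deep

    -- A node that attaches itself has a parent, so the apex did not move: it was a terminal before
    -- and bears its own identifier.
    apex-root : ∀ {v k r} → Path σ₁ v k r → root (σ r) ≡ ident r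
    apex-root path with chain-root path
    ... | top-path@(top _ e) with fate top-path
    ...   | already _ root≡     = root≡
    ...   | unmoved _ _ root≡ _ = root≡
    ...   | moved _ _ _ _ _ _ _ _ with attach-round _ (chain-valid top-path)
    ...     | red-stays _ e₁    = root-path (top (chain-valid top-path) (trans (sym e₁) e))
    ...     | blue-stays _ _ e₁ = root-path (top (chain-valid top-path) (trans (sym e₁) e))
    ...     | moves _ _ _ _ e₁ with () ← trans (sym e) e₁

    -- The terminal of v after all attachments; the value at dead nodes is irrelevant.
    ρ : Fin n → Fin n
    ρ v with alive? σ v
    ... | yes a = Merged.apex (merging v a)
    ... | no _  = v

    ρ-path : ∀ {v k r} → Path σ₁ v k r → ρ v ≡ r
    ρ-path {v} path with alive? σ v
    ... | yes a = proj₂ (chain-unique (Merged.path (merging v a)) path)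
    ... | no ¬a = ⊥-elim (¬a (chain-valid path))

    path-ρ : ∀ {v r} → Alive σ v → ρ v ≡ r → ∃[ k ] Path σ₁ v k r
    path-ρ {v} a eq = _ , subst (Path σ₁ v _) (trans (sym (ρ-path path)) eq) path
      where open Merged (merging v a)

    Class : Fin n → Fin n → Set
    Class r v = Alive σ v × ρ v ≡ r

    class? : ∀ r → Decidable (Class r)
    class? r v = alive? σ v ×-dec (ρ v Fin.≟ r)

    -- Aliveness is repeated so that the indicator is literally the product of those of `class?` and
    -- of `tally`.
    coloured? : ∀ c r → Decidable λ v → Class r v × (Alive σ v × red i (σ v) ≡ c)
    coloured? c r v = class? r v ×-dec (alive? σ v ×-dec (red i (σ v) ≟ᵇ c))

    size : Bool → Fin n → ℕ
    size c r = # (coloured? c r)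

    sweep-depth : ∀ v → Alive σ v → ∃[ k ] ∃[ r ] Path σ₁ v k r × k ≤ m
    sweep-depth v a with merging v a
    ... | merged r path _ _ _ = _ , r , path , <⇒≤ (depth< path)

    sweep-total : ∀ c → sum (λ v → token (σ₂ v) c) < 2 ^ w
    sweep-total c = ≤-<-trans (#≤n λ v → alive? σ v ×-dec (red i (σ v) ≟ᵇ c)) n<2^w

    module Up = Upcast σ₂ m sweep-depth sweep-total

    verdict : Fin n → Bool
    verdict r = size true r ≤ᵇ K * size false r

    verdict-true : ∀ {r} → verdict r ≡ true → size true r ≤ K * size false r
    verdict-true {r} e = ≤ᵇ⇒≤ _ _ (subst T (sym e) _)

    verdict-false : ∀ {r} → verdict r ≡ false → K * size false r < size true r
    verdict-false {r} e = ≰⇒> λ x≤ → subst T e (≤⇒≤ᵇ x≤)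

    -- One step of a phase: survival, growth and charging

    module After (σ₃ : Config) (counted : Up.Inv m σ₃)
                 (σ₅ : Config) (decided : Downcast (round (decide K) σ₃) m σ₅) where
      module σ₃ = Up.Inv counted
      module σ₅ = Downcast decided

      σ₄ σ₆ : Config
      σ₄ = round (decide K) σ₃
      σ₆ = round (settle i) σ₅

      -- A merged tree is closed under parent links, so its total is unchanged by the upcast; all
      -- its nodes but `r` are drained, so this total sits at `r`.
      tokens : ∀ {r} c → Path σ₁ r 0 r → token (σ₃ r) c ≡ size c r
      tokens {r} c path = begin
        token (σ₃ r) c                               ≡⟨ +-identityʳ _ ⟨
        1 * token (σ₃ r) c
          ≡⟨ cong (_* token (σ₃ r) c) (𝟙-true (class? r r) (chain-valid path , ρ-path path)) ⟨
        𝟙 (class? r r) * token (σ₃ r) c              ≡⟨ sum-single (λ v → 𝟙 (class? r v) * token (σ₃ v) c) r elsewhere ⟨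
        sum (λ v → 𝟙 (class? r v) * token (σ₃ v) c)  ≡⟨ σ₃.total (class? r) closed c ⟩
        sum (λ v → 𝟙 (class? r v) * token (σ₂ v) c)
          ≡⟨ sum-cong-≗ (λ v → 𝟙-* (class? r v) (alive? σ v ×-dec (red i (σ v) ≟ᵇ c))) ⟩
        size c r                                     ∎
        where
        open ≡-Reasoning
        closed : Up.Closed (Class r)
        closed u p a e with merging u a
        ... | merged r′ path′ _ _ _ with chain-parent p e path′
        ...   | _ , _ , path″ = (λ (_ , eq) → chain-valid path″ , trans (ρ-path path″) (trans (sym (ρ-path path′)) eq))
                              , (λ (_ , eq) → a , trans (ρ-path path′) (trans (sym (ρ-path path″)) eq))
        elsewhere : ∀ v → v ≢ r → 𝟙 (class? r v) * token (σ₃ v) c ≡ 0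
        elsewhere v v≢r = 𝟙-*-zero (class? r v) λ (a , eq) → drained (path-ρ a eq)
          where
          drained : ∃[ k ] Path σ₁ v k r → token (σ₃ v) c ≡ 0
          drained (_ , top _ _)              = ⊥-elim (v≢r refl)
          drained (_ , path′@(link _ _ _ _)) = σ₃.drained c (m≤m+n m _) path′

      core₅ : ∀ v → core (σ₅ v) ≡ core (σ₁ v)
      core₅ v = trans (σ₅.core≈ v) (σ₃.core≈ v)

      module _ {v k r} (path : Path σ₁ v k r) where

        root₅ : target (σ₅ v) ≡ ident r × accept (σ₅ v) ≡ verdict r
        root₅ with σ₅.root≡ (depth< path) (path-≈ {σ = σ₁} {τ = σ₄} σ₃.core≈ path)
        ... | target≡ , accept≡ = trans target≡ (trans (cong Core.root (σ₃.core≈ r)) (apex-root path))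
                                , trans accept≡ 
              (cong₂ (λ x y → x ≤ᵇ K * y) (tokens true (chain-root path)) (tokens false (chain-root path)))

        alive₆ : alive (σ₆ v) ≡ red i (σ v) ∨ (not (bit i (ident r)) ∨ verdict r)
        alive₆ = trans
          (cong (λ x → Core.alive x ∧ (bit i (Core.root x) ∨ (not (bit i (target (σ₅ v))) ∨ accept (σ₅ v)))) (core₅ v))
          (trans (cong (_∧ (red i (σ v) ∨ (not (bit i (target (σ₅ v))) ∨ accept (σ₅ v)))) (chain-valid path))
            (cong₂ (λ x y → red i (σ v) ∨ (not (bit i x) ∨ y)) (proj₁ root₅) (proj₂ root₅)))

        Survives : Set
        Survives = Red v ⊎ (bit i (ident r) ≡ false ⊎ verdict r ≡ true)

        survive : Survives → Alive σ₆ v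
        survive s = trans alive₆ (keeps-true s)

        survived : Alive σ₆ v → Survives
        survived a = true-keeps (trans (sym alive₆) a)

        died : ¬ Alive σ₆ v → Blue v × bit i (ident r) ≡ true × verdict r ≡ false
        died ¬a = ¬keeps λ e → ¬a (trans alive₆ e)

      alive₆← : ∀ {v} → Alive σ₆ v → Alive σ v
      alive₆← {v} a = trans (sym (cong Core.alive (core₅ v))) (∧-conicalˡ _ _ a)

      parent₆ : ∀ v → parent (σ₆ v) ≡ parent (σ₁ v)
      parent₆ v = cong Core.parent (core₅ v)

      level₆ : ∀ v → level (σ₆ v) ≡ level (σ v)
      level₆ v = cong Core.level (core₅ v)

      path₆← : ∀ {v k r} → Path σ₆ v k r → Path σ₁ v k r
      path₆← = chain-map λ v a → alive₆← a , sym (parent₆ v)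

      -- The ancestors of a survivor survive: the verdict is common to the whole tree, and a node
      -- that survives for being red has a red parent.
      path₆ : ∀ {v k r} → Alive σ₆ v → Path σ₁ v k r → Path σ₆ v k r
      path₆ {v} a₆ (top a e) = top a₆ (trans (parent₆ v) e)
      path₆ {v} a₆ path@(link a p e c) =
        link a₆ p (trans (parent₆ v) e) (path₆ (survive c (parent-survives (survived path a₆))) c)
        where
        parent-survives : Survives path → Survives c
        parent-survives (inj₂ s) = inj₂ s
        parent-survives (inj₁ colour) with attach-round v a
        ... | red-stays _ e₁ = inj₁ (red-parent p a (trans (sym e₁) e) colour)
        ... | moves blue _ _ _ _ = ¬both colour blue
        ... | blue-stays blue _ _ = ¬both colour blue

      member₆ : ∀ {v k r} → Path σ₁ v k r → root (σ₆ v) ≡ ident r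
      member₆ path = proj₁ (root₅ path)

      accept₆ : ∀ {v k r} → Path σ₁ v k r → accept (σ₆ v) ≡ verdict r
      accept₆ path = proj₂ (root₅ path)

      red₆ : ∀ {v k r b} → Path σ₁ v k r → red i (σ₆ v) ≡ b → bit i (ident r) ≡ b
      red₆ path = trans (cong (bit i) (sym (member₆ path)))

      -- A blue node can come to `r` only below some `z` that attached to a red node of the old
      -- tree. By `uniform` that red node is stalled, and then its alive neighbour `z` cannot be
      -- blue.
      no-blue : ∀ r → bit i (ident r) ≡ true → accept (σ r) ≡ false → size false r ≡ 0
      no-blue r red-r stalled-r = #-zero (coloured? false r) λ v ((a , ρ≡) , _ , blue) →
          absurd (fate (proj₂ (path-ρ a ρ≡))) blue
        where
        absurd : ∀ {v} → Fate v r → ¬ Blue v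
        absurd (already colour _) blue = ¬both colour blue
        absurd (unmoved _ _ root≡ _) blue = ¬both red-r (red-root false root≡ blue)
        absurd (moved _ z q a blue b colour root≡) _ with path-root b root≡
        ... | _ , path = ¬both
          (stalled (port z q) (back z q) (b , colour , trans (uniform path) stalled-r)
            (subst (Alive σ) (sym (port-back z q)) a))
          (subst Blue (sym (port-back z q)) blue)

      red-class : ∀ {v k r} → Path σ₁ v k r → Red v → root (σ v) ≡ ident r
      red-class path colour with fate path
      ... | already _ root≡      = root≡
      ... | moved blue _ _ _ _ _ _ _ = ¬both colour blue
      ... | unmoved blue _ _ _   = ¬both colour blue

      member-ρ : ∀ {v r} → Alive σ v → Red v → root (σ v) ≡ ident r → ρ v ≡ r
      member-ρ a colour root≡ with path-root a root≡
      ... | _ , path = ρ-path (red-path path colour)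

      -- Rejection is final within a phase: afterwards the offer is empty while the red count is
      -- positive, so the tree rejects again.
      accepted : ∀ {v r} → Alive σ v → Red v → ρ v ≡ r → verdict r ≡ true → accept (σ r) ≢ false
      accepted {v} {r} a colour ρ≡ yes-r stalled-r = <⇒≱ (#-pos (coloured? true r) v ((a , ρ≡) , a , colour)) (begin
        size true r          ≤⟨ verdict-true {r} yes-r ⟩
        K * size false r     ≡⟨ cong (K *_) (no-blue r (red-root true (red-class path colour) colour) stalled-r) ⟩
        K * 0                ≡⟨ *-zeroʳ K ⟩
        0                    ∎)
        where
        open ≤-Reasoning
        path = proj₂ (path-ρ a ρ≡)

      -- With `x` old members and an offer of `y` nodes, acceptance means `x ≤ K * y`. Hence
      -- `K * (x + y)` is at least `suc K * x`, a growth by the factor 1 + 1/K.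
      grown₆ : ∀ r → Alive σ₆ r → parent (σ₆ r) ≡ nothing → red i (σ₆ r) ≡ true → accept (σ₆ r) ≡ true →
               suc K ^ suc t ≤ K ^ suc t * # (member? σ₆ r)
      grown₆ r a₆ e₆ colour₆ yes₆ = begin
        suc K * suc K ^ t                              ≤⟨ *-monoʳ-≤ (suc K) (grown r a parent≡ colour ¬stalled) ⟩
        suc K * (K ^ t * # (member? σ r))              ≤⟨ *-monoʳ-≤ (suc K) (*-monoʳ-≤ (K ^ t) old≤x) ⟩
        suc K * (K ^ t * x)                            ≡⟨ solve 3 (λ K P x → (con 1 :+ K) :* (P :* x) :=
                                                            P :* (x :+ K :* x)) refl K (K ^ t) x ⟩
        K ^ t * (x + K * x)                            ≤⟨ *-monoʳ-≤ (K ^ t) (+-monoˡ-≤ (K * x) (verdict-true {r} yes-r)) ⟩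
        K ^ t * (K * y + K * x)                        ≡⟨ solve 4 (λ K P x y → P :* (K :* y :+ K :* x) :=
                                                            K :* P :* (x :+ y)) refl K (K ^ t) x y ⟩
        K ^ suc t * (x + y)                            ≤⟨ *-monoʳ-≤ (K ^ suc t) x+y≤new ⟩
        K ^ suc t * # (member? σ₆ r)                   ∎
        where
        open ≤-Reasoning
        open +-*-Solver
        x = size true r
        y = size false r
        a : Alive σ r
        a = alive₆← a₆
        path : Path σ₁ r 0 r
        path = top a (trans (sym (parent₆ r)) e₆)
        yes-r : verdict r ≡ true
        yes-r = trans (sym (accept₆ path)) yes₆
        colour : Red r
        colour = trans (cong (bit i) (apex-root path)) (red₆ path colour₆)
        ¬stalled : accept (σ r) ≡ true
        ¬stalled = ¬-not (accepted a colour (ρ-path path) yes-r)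
        parent≡ : parent (σ r) ≡ nothing
        parent≡ with path-root a (apex-root path)
        ... | _ , old = proj₂ (chain-top (chain-root old))
        old≤x : # (member? σ r) ≤ x
        old≤x = #-mono (member? σ r) (coloured? true r) λ v (b , root≡) →
          let red-v = trans (cong (bit i) root≡) (red₆ path colour₆)
          in (b , member-ρ b red-v root≡) , b , red-v
        member-new : ∀ {v} → Class r v → Member σ₆ r v
        member-new (b , ρ≡) with path-ρ b ρ≡
        ... | _ , path′ = survive path′ (inj₂ (inj₂ yes-r)) , member₆ path′
        x+y≤new : x + y ≤ # (member? σ₆ r)
        x+y≤new = begin
          x + y   ≤⟨ +-mono-≤
                       (#-mono (coloured? true r) (λ v → member? σ₆ r v ×-dec (red i (σ v) ≟ᵇ true))
                         λ v (cls , _ , red-v) → member-new cls , red-v)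
                       (#-mono (coloured? false r) (λ v → member? σ₆ r v ×-dec ¬? (red i (σ v) ≟ᵇ true))
                         λ v (cls , _ , blue-v) → member-new cls , λ red-v → ¬both red-v blue-v) ⟩
          _       ≡⟨ #-split (member? σ₆ r) (λ v → red i (σ v) ≟ᵇ true) ⟨
          # (member? σ₆ r) ∎

      Dead : Fin n → Set
      Dead v = Alive σ v × ¬ Alive σ₆ v

      dead? : Decidable Dead
      dead? v = alive? σ v ×-dec ¬? (alive? σ₆ v)

      -- Amortised counting tree by tree. When a red tree rejects for the first time, `K` times the
      -- number of removed nodes is less than its red count, and all its red nodes become stalled,
      -- which pays for them. In every other case no node dies and no stalled node is lost.
      class-deaths : ∀ r → K * # (λ v → (ρ v Fin.≟ r) ×-dec dead? v) + # (λ v → (ρ v Fin.≟ r) ×-dec stalled? i σ v)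
                           ≤ # (λ v → (ρ v Fin.≟ r) ×-dec stalled? i σ₆ v)
      class-deaths r = by-verdict (verdict r) refl
        where
        open ≤-Reasoning
        d? : Decidable λ v → ρ v ≡ r × Dead v
        d? v = (ρ v Fin.≟ r) ×-dec dead? v
        s? : Decidable λ v → ρ v ≡ r × Stalled i σ v
        s? v = (ρ v Fin.≟ r) ×-dec stalled? i σ v
        s₆? : Decidable λ v → ρ v ≡ r × Stalled i σ₆ v
        s₆? v = (ρ v Fin.≟ r) ×-dec stalled? i σ₆ v
        dead-facts : ∀ {v} → ρ v ≡ r → Dead v → Blue v × bit i (ident r) ≡ true × verdict r ≡ false
        dead-facts ρ≡ (a , ¬a₆) = died (proj₂ (path-ρ a ρ≡)) ¬a₆
        no-deaths : # d? ≡ 0 → # s? ≤ # s₆? → K * # d? + # s? ≤ # s₆?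
        no-deaths d≡0 s≤ = begin
          K * # d? + # s?  ≡⟨ cong (λ d → K * d + # s?) d≡0 ⟩
          K * 0 + # s?     ≡⟨ cong (_+ # s?) (*-zeroʳ K) ⟩
          # s?             ≤⟨ s≤ ⟩
          # s₆?            ∎
        stalled-root : ∀ {v} → ρ v ≡ r → Stalled i σ v → accept (σ r) ≡ false
        stalled-root ρ≡ (a , colour , no-v) with path-root a (red-class (proj₂ (path-ρ a ρ≡)) colour)
        ... | _ , path = trans (sym (uniform path)) no-v
        red-stalled : verdict r ≡ false → ∀ {v} → Alive σ v → Red v → ρ v ≡ r → ρ v ≡ r × Stalled i σ₆ v
        red-stalled no-r a colour ρ≡ with path-ρ a ρ≡
        ... | _ , path = ρ≡ , survive path (inj₁ colour)
                       , trans (cong (bit i) (member₆ path)) (red-root true (red-class path colour) colour)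
                       , trans (accept₆ path) no-r
        by-verdict : ∀ b → verdict r ≡ b → K * # d? + # s? ≤ # s₆?
        by-verdict true yes-r = no-deaths
          (#-zero d? λ v (ρ≡ , dead) → ¬both yes-r (proj₂ (proj₂ (dead-facts ρ≡ dead))))
          (≤-trans (≤-reflexive (#-zero s? λ v (ρ≡ , s@(a , colour , _)) →
                     accepted a colour ρ≡ yes-r (stalled-root ρ≡ s))) z≤n)
        by-verdict false no-r = by-colour (bit i (ident r)) refl (accept (σ r)) refl
          where
          s≤s₆ : # s? ≤ # s₆?
          s≤s₆ = #-mono s? s₆? λ v (ρ≡ , a , colour , _) → red-stalled no-r a colour ρ≡
          d≤y : # d? ≤ size false r
          d≤y = #-mono d? (coloured? false r) λ v (ρ≡ , dead) → (proj₁ dead , ρ≡) , proj₁ dead , proj₁ (dead-facts ρ≡ dead)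
          by-colour : ∀ b → bit i (ident r) ≡ b → ∀ c → accept (σ r) ≡ c → K * # d? + # s? ≤ # s₆?
          by-colour false blue-r _ _ = no-deaths
            (#-zero d? λ v (ρ≡ , dead) → ¬both (proj₁ (proj₂ (dead-facts ρ≡ dead))) blue-r) s≤s₆
          by-colour true red-r false old-no = no-deaths
            (n≤0⇒n≡0 (≤-trans d≤y (≤-reflexive (no-blue r red-r old-no)))) s≤s₆
          by-colour true red-r true old-yes = begin
            K * # d? + # s?        ≡⟨ cong (K * # d? +_) (#-zero s? λ v (ρ≡ , s) → ¬both old-yes (stalled-root ρ≡ s)) ⟩
            K * # d? + 0           ≡⟨ +-identityʳ _ ⟩
            K * # d?               ≤⟨ *-monoʳ-≤ K d≤y ⟩
            K * size false r       ≤⟨ <⇒≤ (verdict-false {r} no-r) ⟩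
            size true r            ≤⟨ #-mono (coloured? true r) s₆? (λ v ((a , ρ≡) , _ , colour) →
                                        red-stalled no-r a colour ρ≡) ⟩
            # s₆?                  ∎

      deaths₆ : K * A₀ ≤ K * # (alive? σ₆) + # (stalled? i σ₆)
      deaths₆ = begin
        K * A₀                                             ≤⟨ deaths ⟩
        K * # (alive? σ) + # (stalled? i σ)                ≤⟨ +-monoˡ-≤ _ (*-monoʳ-≤ K alive-split) ⟩
        K * (# (alive? σ₆) + # dead?) + # (stalled? i σ)   ≡⟨ cong (_+ # (stalled? i σ)) (*-distribˡ-+ K (# (alive? σ₆)) _) ⟩
        K * # (alive? σ₆) + K * # dead? + # (stalled? i σ) ≡⟨ +-assoc (K * # (alive? σ₆)) _ _ ⟩
        K * # (alive? σ₆) + (K * # dead? + # (stalled? i σ)) ≤⟨ +-monoʳ-≤ (K * # (alive? σ₆)) charge ⟩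
        K * # (alive? σ₆) + # (stalled? i σ₆)              ∎
        where
        open ≤-Reasoning
        alive-split : # (alive? σ) ≤ # (alive? σ₆) + # dead?
        alive-split = begin
          # (alive? σ)    ≡⟨ #-split (alive? σ) (alive? σ₆) ⟩
          _ + # dead?     ≤⟨ +-monoˡ-≤ (# dead?) (#-mono (λ v → alive? σ v ×-dec alive? σ₆ v) (alive? σ₆) λ v → proj₂) ⟩
          # (alive? σ₆) + # dead? ∎
        in-class : ∀ {P : Fin n → Set} → Decidable P → Fin n → ℕ
        in-class P? r = # λ v → (ρ v Fin.≟ r) ×-dec P? v
        charge : K * # dead? + # (stalled? i σ) ≤ # (stalled? i σ₆)
        charge = begin
          K * # dead? + # (stalled? i σ)
            ≡⟨ cong₂ (λ d s → K * d + s) (#-partition dead? ρ) (#-partition (stalled? i σ) ρ) ⟩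
          K * sum (in-class dead?) + sum (in-class (stalled? i σ))
            ≡⟨ cong (_+ sum (in-class (stalled? i σ))) (*-distribˡ-sum K (in-class dead?)) ⟩
          sum (λ r → K * in-class dead? r) + sum (in-class (stalled? i σ))
            ≡⟨ ∑-distrib-+ (λ r → K * in-class dead? r) (in-class (stalled? i σ)) ⟨
          sum (λ r → K * in-class dead? r + in-class (stalled? i σ) r)
            ≤⟨ sum-mono class-deaths ⟩
          sum (in-class (stalled? i σ₆))
            ≡⟨ #-partition (stalled? i σ₆) ρ ⟨
          # (stalled? i σ₆) ∎

      -- A stalled node was red before the step. An alive neighbour that is blue afterwards would be
      -- unmoved, hence would have had no red alive neighbour to attach to.
      stalled₆ : ∀ v p → Stalled i σ₆ v → Alive σ₆ (port v p) → red i (σ₆ (port v p)) ≡ true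
      stalled₆ v p (a₆ , colour₆ , no-v) b₆ with merging v (alive₆← a₆) | merging (port v p) (alive₆← b₆)
      ... | merged r path _ _ _ | merged r′ path′ _ fate′ _ = trans (cong (bit i) (member₆ path′)) (recoloured fate′)
        where
        red-v : Red v
        red-v with survived path a₆
        ... | inj₁ colour       = colour
        ... | inj₂ (inj₁ blue)  = ¬both (red₆ path colour₆) blue
        ... | inj₂ (inj₂ yes-r) = ¬both yes-r (trans (sym (accept₆ path)) no-v)
        recoloured : ∀ {r′} → Fate (port v p) r′ → bit i (ident r′) ≡ true
        recoloured (already colour root≡)           = red-root true root≡ colour
        recoloured (moved _ _ _ _ _ _ colour root≡) = red-root true root≡ colour
        recoloured (unmoved _ blues _ _)            =
          ¬both red-v (subst Blue (port-back v p)
            (blues (back v p) (subst (Alive σ) (sym (port-back v p)) (alive₆← a₆))))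

      blue-link₆ : ∀ v p → Alive σ₆ v → red i (σ₆ v) ≡ false → parent (σ₆ v) ≡ just (toℕ p) →
                   suc (level (σ₆ (port v p))) ≤ level (σ₆ v)
      blue-link₆ v p a₆ blue₆ e₆ with merging v (alive₆← a₆)
      ... | merged r path _ (already colour root≡) _ = ¬both (red-root true root≡ colour) (red₆ path blue₆)
      ... | merged r path _ (moved _ _ _ _ _ _ colour root≡) _ = ¬both (red-root true root≡ colour) (red₆ path blue₆)
      ... | merged r path _ (unmoved blue _ _ e₁) _ =
        subst₂ _≤_ (cong suc (sym (level₆ (port v p)))) (sym (level₆ v))
          (blue-link v p (alive₆← a₆) blue (trans (sym e₁) (trans (sym (parent₆ v)) e₆)))

      low₆ : ∀ v → Alive σ₆ v → ∀ j → j < i → bit j (root (σ₆ v)) ≡ bit j (root (σ v))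
      low₆ v a₆ j j<i with merging v (alive₆← a₆)
      ... | merged r path _ _ low = trans (cong (bit j) (member₆ path)) (low j j<i)

      rooted₆ : ∀ v → Alive σ₆ v → Rooted σ₆ v (level (σ₆ v) + 2 * suc t)
      rooted₆ v a₆ with merging v (alive₆← a₆)
      ... | merged r path k≤ _ _ = rooted-at r (path₆ a₆ path)
            (subst (λ l → _ ≤ l + 2 * suc t) (sym (level₆ v)) k≤) (member₆ path)

      within₆ : Within A₀ i D (suc t) σ₆
      within₆ = record
        { rooted    = rooted₆
        ; uniform   = λ path → trans (accept₆ (path₆← path)) (sym (accept₆ (chain-root (path₆← path))))
        ; shallow   = λ v a₆ → subst (_≤ D) (sym (level₆ v)) (shallow v (alive₆← a₆))
        ; smooth    = λ v p a₆ b₆ → subst₂ _≤_ (sym (level₆ (port v p))) (cong suc (sym (level₆ v)))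
                        (smooth v p (alive₆← a₆) (alive₆← b₆))
        ; blue-link = blue-link₆
        ; separated = λ v p a₆ b₆ j j<i → trans (low₆ v a₆ j j<i)
                        (trans (separated v p (alive₆← a₆) (alive₆← b₆) j j<i) (sym (low₆ (port v p) b₆ j j<i)))
        ; stalled   = stalled₆
        ; grown     = grown₆
        ; deaths    = deaths₆
        }

  one-step : ∀ {A₀ i D t σ} m → Within A₀ i D t σ → D + 2 * suc t < m →
         Within A₀ i D (suc t) (exec (stepOps m K i) σ)
  one-step {A₀} {i} {D} {t} {σ} m within deep = subst (Within A₀ i D (suc t)) (sym unfolded) within₆
    where
    open Step within m deep
    σ₃ = exec (repeat m up) σ₂
    τ  = round (decide K) σ₃
    τ-small : ∀ v → Alive τ v → parent (τ v) ≡ nothing → root (τ v) < 2 ^ w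
    τ-small v a e = subst (_< 2 ^ w)
      (sym (trans (cong Core.root (core≈ v)) (apex-root (top {A = Alive σ} {par = λ u → parent (σ₁ u)}
        (trans (sym (cong Core.alive (core≈ v))) a) (trans (sym (cong Core.parent (core≈ v))) e)))))
      (ident< v)
      where open Up.Inv Up.upcast
    open After σ₃ Up.upcast (exec (repeat m down) τ) (downcast m τ τ-small)
    unfolded : exec (stepOps m K i) σ ≡ σ₆
    unfolded = trans (exec-++ (repeat m up) (decide K ∷ repeat m down ++ settle i ∷ []) σ₂)
                     (exec-++ (repeat m down) (settle i ∷ []) τ)

  -- Whole phases

  module _ (m S : ℕ) (exceeds : K ^ S * n < suc K ^ S) where

    -- A red tree still accepting after `S` steps would have more than `n` nodes, so every red node
    -- is stalled and has only red neighbours: bit `i` is now separated. There are at most `n`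
    -- stalled nodes, so the phase costs at most n/K nodes.
    finish : ∀ {i D σ τ} → Between i D σ → Within (# (alive? σ)) i D S τ → Between (suc i) (D + 2 * S) τ
    finish {i} {D} {σ} {τ} before within = record
      { rooted    = λ v a → let rooted-at r path k≤ root≡ = rooted v a
                            in rooted-at r path (≤-trans k≤ (+-monoˡ-≤ (2 * S) (shallow v a))) root≡
      ; separated = separated′
      ; survivors = survivors′
      }
      where
      open Within within
      open Between before using (survivors)
      all-stalled : ∀ v → Alive τ v → red i (τ v) ≡ true → Stalled i τ v
      all-stalled v a colour = a , colour , trans (uniform path) (¬-not λ yes-r →
          <⇒≱ exceeds (≤-trans (grown r (chain-valid top-path) (chain-root-top path) colour-r yes-r)
                                (*-monoʳ-≤ (K ^ S) (#≤n (member? τ r)))))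
        where
        open Rooted (rooted v a) renaming (apex to r)
        top-path = chain-root path
        colour-r : red i (τ r) ≡ true
        colour-r with rooted r (chain-valid top-path)
        ... | rooted-at _ path′ _ root≡′ with _ , refl ← chain-unique top-path path′ =
          trans (cong (bit i) (trans root≡′ (sym root≡))) colour
      same-colour : ∀ v p → Alive τ v → Alive τ (port v p) → red i (τ v) ≡ red i (τ (port v p))
      same-colour v p a b with red i (τ v) in eq | red i (τ (port v p)) in eq′
      ... | true  | true  = refl
      ... | false | false = refl
      ... | true  | false with () ← trans (sym eq′) (stalled v p (all-stalled v a eq) b)
      ... | false | true  with () ← trans (sym eq) (subst (λ u → red i (τ u) ≡ true) (port-back v p)
              (stalled (port v p) (back v p) (all-stalled (port v p) b eq′) (subst (Alive τ) (sym (port-back v p)) a)))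
      separated′ : Separated (suc i) τ
      separated′ v p a b j j<1+i with m≤n⇒m<n∨m≡n j<1+i
      ... | inj₁ (s≤s j<i) = separated v p a b j j<i
      ... | inj₂ refl      = same-colour v p a b
      survivors′ : K * n ≤ K * # (alive? τ) + suc i * n
      survivors′ = begin
        K * n                                            ≤⟨ survivors ⟩
        K * # (alive? σ) + i * n                         ≤⟨ +-monoˡ-≤ (i * n) deaths ⟩
        K * # (alive? τ) + # (stalled? i τ) + i * n      ≤⟨ +-monoˡ-≤ (i * n) (+-monoʳ-≤ (K * # (alive? τ)) (#≤n (stalled? i τ))) ⟩
        K * # (alive? τ) + n + i * n                     ≡⟨ +-assoc (K * # (alive? τ)) n (i * n) ⟩
        K * # (alive? τ) + suc i * n                     ∎
        where open ≤-Reasoning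

    phase : ∀ {i D σ} → D + 2 * S < m → Between i D σ → Between (suc i) (D + 2 * S) (exec (phaseOps m S K i) σ)
    phase {i} {D} {σ} deep before = subst (Between (suc i) (D + 2 * S)) (sym (exec-++ (repeat m bfs) _ _))
      (finish before (exec-loop (Within (# (alive? σ)) i D) S (Bfs.grow before m (≤-<-trans (m≤m+n D _) deep))
        λ t τ t<S inv → one-step m inv (≤-<-trans (+-monoʳ-≤ D (*-monoʳ-≤ 2 t<S)) deep)))

    phases : ∀ b {σ} → b * (2 * S) < m → Between 0 0 σ → Between b (b * (2 * S)) (exec (program m S K b) σ)
    phases b deep before = exec-loop (λ i → Between i (i * (2 * S))) b before λ i τ i<b inv →
      subst (λ D → Between (suc i) D (exec (phaseOps m S K i) τ)) (+-comm (i * (2 * S)) (2 * S))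
        (phase (≤-<-trans (≤-trans (≤-reflexive (+-comm (i * (2 * S)) (2 * S))) (*-monoˡ-≤ (2 * S) i<b)) deep) inv)

  unclustered : Between 0 0 (initial ∘ ident)
  unclustered = record
    { rooted    = λ v a → rooted-at v (top a refl) z≤n refl
    ; separated = λ _ _ _ _ _ ()
    ; survivors = ≤-reflexive (sym (trans (+-identityʳ _) (cong (K *_) (#-full (alive? (initial ∘ ident)) λ _ → refl))))
    }

  -- Clusters and their diameter

  module _ {P : Fin n → Set} where

    walk-++ : ∀ {u v x k l} → WalkIn G P u v k → WalkIn G P v x l → WalkIn G P u x (k + l)
    walk-++ (here _)       walk = walk
    walk-++ (step p e rest) walk = step p e (walk-++ rest walk)

    walk-up : ∀ {σ v k r} → Path σ v k r → (∀ {u l} → Path σ u l r → P u) → WalkIn G P v r k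
    walk-up path@(top _ _)      inside = here (inside path)
    walk-up {σ} path@(link _ p _ c) inside = step (inside path) (p , refl) (walk-up {σ} c inside)

    walk-down : ∀ {σ v k r} → Path σ v k r → (∀ {u l} → Path σ u l r → P u) → WalkIn G P r v k
    walk-down path@(top _ _)      inside = here (inside path)
    walk-down {σ} {v = v} {k = suc k} path@(link _ p _ c) inside = subst (WalkIn G P _ _) (+-comm k 1)
      (walk-++ (walk-down {σ} c inside) (step (inside c) (back v p , port-back v p) (here (inside path))))

  -- With `K = 2 * b`, the losses of `b` phases leave half of the nodes. Roots have at most `b`
  -- bits, so separation makes adjacent roots equal. Nodes of one cluster share their terminal, and
  -- the walk up to it and down again has length at most `D + D` inside the cluster.
  clustering : ∀ b {D σ} .{{_ : NonZero b}} → K ≡ 2 * b → w ≤ b → Between b D σ →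
               (out : Fin n → Bool × ℕ) → (∀ v → out v ≡ (alive (σ v) , root (σ v))) →
               GoodClustering G out (D + D)
  clustering b {D} {σ} refl w≤b between out out≡ = half , joined-up , diameter
    where
    open Between between
    alive→ : ∀ v → proj₁ (out v) ≡ true → Alive σ v
    alive→ v e = trans (sym (cong proj₁ (out≡ v))) e
    alive← : ∀ v → Alive σ v → proj₁ (out v) ≡ true
    alive← v a = trans (cong proj₁ (out≡ v)) a
    root< : ∀ v → Alive σ v → root (σ v) < 2 ^ b
    root< v a = <-≤-trans (subst (_< 2 ^ w) (sym root≡) (ident< apex)) (^-monoʳ-≤ 2 w≤b)
      where open Rooted (rooted v a)
    half : n ≤ 2 * count (λ v → proj₁ (out v))
    half rewrite count-# (λ v → proj₁ (out v)) (alive? σ) alive← alive→ =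
      *-cancelˡ-≤ b (+-cancelʳ-≤ (b * n) (b * n) (b * (2 * # (alive? σ))) (begin
        b * n + b * n                          ≡⟨ solve 2 (λ b n → b :* n :+ b :* n := con 2 :* b :* n) refl b n ⟩
        2 * b * n                              ≤⟨ survivors ⟩
        2 * b * # (alive? σ) + b * n           ≡⟨ solve 3 (λ b n x → con 2 :* b :* x :+ b :* n :=
                                                    b :* (con 2 :* x) :+ b :* n) refl b n (# (alive? σ)) ⟩
        b * (2 * # (alive? σ)) + b * n         ∎))
      where
      open ≤-Reasoning
      open +-*-Solver
    joined-up : ∀ u v → proj₁ (out u) ≡ true → proj₁ (out v) ≡ true → Adj G u v → proj₂ (out u) ≡ proj₂ (out v)
    joined-up u _ a b (p , refl) = trans (cong proj₂ (out≡ u)) (trans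
      (bit-ext _ (root< u (alive→ u a)) (root< (port u p) (alive→ (port u p) b))
        (separated u p (alive→ u a) (alive→ (port u p) b)))
      (sym (cong proj₂ (out≡ (port u p)))))
    same-root : ∀ x y → proj₂ (out x) ≡ proj₂ (out y) → root (σ x) ≡ root (σ y)
    same-root x y e = trans (sym (cong proj₂ (out≡ x))) (trans e (cong proj₂ (out≡ y)))
    diameter : ∀ v → proj₁ (out v) ≡ true → DiamLe G (Cluster G out v) (D + D)
    diameter v _ x y (a , label-x) (b , label-y)
      with rooted x (alive→ x a) | rooted y (alive→ y b)
    ... | rooted-at r path k≤ root≡ | rooted-at r′ path′ l≤ root≡′
      with refl ← ident-inj (trans (sym root≡) (trans (same-root x y (trans label-x (sym label-y))) root≡′)) =
      _ , +-mono-≤ k≤ l≤ , walk-++ (walk-up {σ = σ} path inside) (walk-down {σ = σ} path′ inside)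
      where
      inside : ∀ {u l} → Path σ u l r → Cluster G out v u
      inside {u} p with rooted u (chain-valid p)
      ... | rooted-at _ p′ _ root≡ᵤ with _ , refl ← chain-unique p p′ =
        alive← u (chain-valid p) ,
        trans (cong proj₂ (out≡ u)) (trans (trans root≡ᵤ (sym root≡)) (trans (sym (cong proj₂ (out≡ x))) label-x))

-- Running time

length-loop : ∀ {c} {body : ℕ → List Op} m → (∀ t → L.length (body t) ≡ c) → L.length (loop m body) ≡ m * c
length-loop zero    each = refl
length-loop {c} {body} (suc m) each = trans (L.length-++ (loop m body))
  (trans (cong₂ _+_ (length-loop m each) (each m)) (+-comm (m * c) c))

length-repeat : ∀ m op → L.length (repeat m op) ≡ m
length-repeat m op = trans (length-loop m λ _ → refl) (*-identityʳ m)

length-step : ∀ m K i → L.length (stepOps m K i) ≡ 2 + (m + (1 + (m + 1)))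
length-step m K i = cong (2 +_) (trans (L.length-++ (repeat m up)) (cong₂ _+_ (length-repeat m up)
  (cong suc (trans (L.length-++ (repeat m down)) (cong (_+ 1) (length-repeat m down))))))

length-phase : ∀ m S K i → L.length (phaseOps m S K i) ≡ 1 + (m + S * (2 + (m + (1 + (m + 1)))))
length-phase m S K i = cong suc (trans (L.length-++ (repeat m bfs))
  (cong₂ _+_ (length-repeat m bfs) (length-loop S λ _ → length-step m K i)))

length-program : ∀ m S K b → L.length (program m S K b) ≡ b * (1 + (m + S * (2 + (m + (1 + (m + 1))))))
length-program m S K b = length-loop b (length-phase m S K)

-- L stands for 1 + ⌊log₂ N⌋.  There are width L phases, one for each bit of an identifier, of
-- steps L steps; trees have depth at most width L * (2 * steps L) throughout, less than sweep L.
module Parameters (β : ℕ) where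

  width steps sweep : ℕ → ℕ
  width L = β * L
  steps L = 2 * width L * L
  sweep L = suc (width L * (2 * steps L))

  schedule : ℕ → List Op
  schedule L = program (sweep L) (steps L) (2 * width L) (width L)

  μ : ℕ
  μ = 1 + 4 * β * β

  sweep≤ : ∀ L .{{_ : NonZero L}} → sweep L ≤ μ * L ^ 3
  sweep≤ L = begin
    1 + β * L * (2 * (2 * (β * L) * L))    ≡⟨ solve 2 (λ β L → con 1 :+ β :* L :* (con 2 :* (con 2 :* (β :* L) :* L)) :=
                                                con 1 :+ con 4 :* β :* β :* (L :* (L :* (L :* con 1)))) refl β L ⟩
    1 + 4 * β * β * L ^ 3                  ≤⟨ +-monoˡ-≤ _ (n≢0⇒n>0 (≢-nonZero⁻¹ (L ^ 3))) ⟩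
    μ * L ^ 3                              ∎
    where
    open ≤-Reasoning
    open +-*-Solver
    instance
      L³≢0 : NonZero (L ^ 3)
      L³≢0 = m^n≢0 L 3

  diameter≡ : ∀ L → width L * (2 * steps L) + width L * (2 * steps L) ≡ 8 * β * β * L ^ 3
  diameter≡ L = solve 2 (λ β L → let D = β :* L :* (con 2 :* (con 2 :* (β :* L) :* L)) in
                  D :+ D := con 8 :* β :* β :* (L :* (L :* (L :* con 1)))) refl β L
    where open +-*-Solver

  ν : ℕ
  ν = β * (1 + μ + 2 * β * (4 + 2 * μ))

  rounds≤ : ∀ L .{{_ : NonZero L}} → L.length (schedule L) ≤ ν * L ^ 6
  rounds≤ L = begin
    L.length (schedule L)
      ≡⟨ length-program (sweep L) (steps L) (2 * width L) (width L) ⟩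
    width L * (1 + (s + steps L * (2 + (s + (1 + (s + 1))))))
      ≡⟨ cong (width L *_) (solve 2 (λ s S → con 1 :+ (s :+ S :* (con 2 :+ (s :+ (con 1 :+ (s :+ con 1))))) :=
            con 1 :+ s :+ S :* (con 4 :+ con 2 :* s)) refl s (steps L)) ⟩
    width L * (1 + s + steps L * (4 + 2 * s))
      ≤⟨ *-monoʳ-≤ (width L) (+-mono-≤
           (+-mono-≤ (≤X 1) (sweep≤ L)) (*-monoʳ-≤ (steps L) (+-mono-≤ (≤X 4) (*-monoʳ-≤ 2 (sweep≤ L))))) ⟩
    width L * (1 * X + μ * X + steps L * (4 * X + 2 * (μ * X)))
      -- The contribution of order L^4 is enlarged by the factor L^2, so that the total becomes a
      -- multiple of L^6.
      ≤⟨ *-monoʳ-≤ (width L) (+-monoˡ-≤ _ (≤-trans (≤-reflexive (sym (*-distribʳ-+ X 1 μ)))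
           (m≤m*n ((1 + μ) * X) (L * L) {{m*n≢0 L L}}))) ⟩
    width L * ((1 + μ) * X * (L * L) + steps L * (4 * X + 2 * (μ * X)))
      ≡⟨ solve 3 (λ β L μ → let X = L :* (L :* (L :* con 1)) in
            β :* L :* ((con 1 :+ μ) :* X :* (L :* L) :+ con 2 :* (β :* L) :* L :* (con 4 :* X :+ con 2 :* (μ :* X))) :=
            β :* (con 1 :+ μ :+ con 2 :* β :* (con 4 :+ con 2 :* μ)) :* (L :* (L :* (L :* X)))) refl β L μ ⟩
    ν * L ^ 6 ∎
    where
    open ≤-Reasoning
    open +-*-Solver
    s = sweep L
    X = L ^ 3
    instance
      L³≢0 : NonZero (L ^ 3)
      L³≢0 = m^n≢0 L 3
    ≤X : ∀ c → c ≤ c * X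
    ≤X c = m≤m*n c X

-- From the known bound `N` to the number `n` of nodes

-- From n < 2^ℓ with ℓ = 1 + ⌊log₂ n⌋ one gets N ≤ 2^(ℓ k), so logarithms of `N` exceed those of `n`
-- by a constant factor only.
log-≤ : ∀ k {n N} → N ≤ n ^ k → suc ⌊log₂ N ⌋ ≤ suc k * suc ⌊log₂ n ⌋
log-≤ k {n} {N} N≤n^k = begin
  suc ⌊log₂ N ⌋               ≤⟨ s≤s (⌊log₂⌋-mono-≤ N≤2^) ⟩
  suc ⌊log₂ 2 ^ (ℓ * k) ⌋     ≡⟨ cong suc (⌊log₂[2^n]⌋≡n (ℓ * k)) ⟩
  suc (ℓ * k)                 ≤⟨ s≤s (≤-trans (≤-reflexive (*-comm ℓ k)) (m≤n+m (k * ℓ) ⌊log₂ n ⌋)) ⟩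
  suc k * ℓ                   ∎
  where
  open ≤-Reasoning
  ℓ = suc ⌊log₂ n ⌋
  N≤2^ : N ≤ 2 ^ (ℓ * k)
  N≤2^ = ≤-trans N≤n^k (≤-trans (^-monoˡ-≤ k (<⇒≤ (n<2^suc⌊log₂n⌋ n))) (≤-reflexive (^-*-assoc 2 ℓ k)))

theorem2p1 : (k cId : ℕ) →
    Σ Algorithm λ A → ∃[ cB ] ∃[ cR ] ∃[ cD ] (
    ∀ (n : ℕ) (G : Network n) (ident : Fin n → ℕ) →
    Injective _≡_ _≡_ ident →
    (∀ v → ident v < 2 ^ (cId * suc ⌊log₂ n ⌋)) →
    ∀ (N : ℕ) → n ≤ N → N ≤ n ^ k →
    (Algorithm.rounds A N ≤ cR * (suc ⌊log₂ n ⌋ ^ 6))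
    × GoodClustering G (result A cB N G ident) (cD * (suc ⌊log₂ n ⌋ ^ 3)))
theorem2p1 k cId = A , cB , ν * κ ^ 6 , 8 * β * β * κ ^ 3 , correct
  where
  -- One more than `cId`: `β * L` bits must hold the identifiers as well as counts of up to `n`
  -- nodes, and `n < 2 ^ L`. It also makes `K` positive.
  β = suc cId
  κ = suc k
  -- A message consists of a flag and two numbers of `β * L` bits.
  cB = suc (β + β)
  open Parameters β
  log : ℕ → ℕ
  log N = suc ⌊log₂ N ⌋
  A : Algorithm
  A = algorithm (width ∘ log) (schedule ∘ log)
  scale : ∀ c e {n N} → N ≤ n ^ k → c * log N ^ e ≤ c * κ ^ e * log n ^ e
  scale c e {n} {N} N≤n^k = begin
    c * log N ^ e              ≤⟨ *-monoʳ-≤ c (^-monoˡ-≤ e (log-≤ k {n} {N} N≤n^k)) ⟩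
    c * (κ * log n) ^ e        ≡⟨ cong (c *_) (^-distribʳ-* e κ (log n)) ⟩
    c * (κ ^ e * log n ^ e)    ≡⟨ *-assoc c (κ ^ e) (log n ^ e) ⟨
    c * κ ^ e * log n ^ e      ∎
    where open ≤-Reasoning
  diam-mono : ∀ {n} {G : Network n} {C D D′} → D ≤ D′ → DiamLe G C D → DiamLe G C D′
  diam-mono D≤D′ close u v a b with close u v a b
  ... | l , l≤D , walk = l , ≤-trans l≤D D≤D′ , walk
  correct : ∀ n (G : Network n) (ident : Fin n → ℕ) → Injective _≡_ _≡_ ident →
            (∀ v → ident v < 2 ^ (cId * suc ⌊log₂ n ⌋)) → ∀ N → n ≤ N → N ≤ n ^ k →
            Algorithm.rounds A N ≤ ν * κ ^ 6 * suc ⌊log₂ n ⌋ ^ 6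
            × GoodClustering G (result A cB N G ident) (8 * β * β * κ ^ 3 * suc ⌊log₂ n ⌋ ^ 3)
  correct n G ident ident-inj ident< N n≤N N≤n^k =
    ≤-trans (rounds≤ (log N)) (scale ν 6 {n} N≤n^k) ,
    proj₁ good , proj₁ (proj₂ good) ,
    λ v v∈ → diam-mono (≤-trans (≤-reflexive (diameter≡ (log N))) (scale (8 * β * β) 3 {n} N≤n^k))
                       (proj₂ (proj₂ good) v v∈)
    where
    L b S : ℕ
    L = log N
    b = width L
    S = steps L
    N<2^L : N < 2 ^ L
    N<2^L = n<2^suc⌊log₂n⌋ N
    ident<2^b : ∀ v → ident v < 2 ^ b
    ident<2^b v = <-≤-trans (ident< v) (^-monoʳ-≤ 2 (*-mono-≤ (n≤1+n cId) (s≤s (⌊log₂⌋-mono-≤ n≤N))))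
    n<2^b : n < 2 ^ b
    n<2^b = ≤-<-trans n≤N (<-≤-trans N<2^L (^-monoʳ-≤ 2 (m≤m+n L (cId * L))))
    open Clustering G b ident ident-inj ident<2^b n<2^b (2 * b)
    -- `S` is `K * L` for `K = 2 * b`, so `growth` provides the factor 2^L, which exceeds `N` and
    -- hence `n`.
    exceeds : (2 * b) ^ S * n < suc (2 * b) ^ S
    exceeds = <-≤-trans (*-monoʳ-< ((2 * b) ^ S) {{m^n≢0 (2 * b) S}} (≤-<-trans n≤N N<2^L)) (growth (2 * b) L)
    fits : suc (b + b) ≤ bandwidth cB N
    fits = s≤s (≤-trans (≤-reflexive (sym (*-distribʳ-+ L β β))) (m≤n+m _ ⌊log₂ N ⌋))
    good : GoodClustering G (result A cB N G ident) (b * (2 * S) + b * (2 * S))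
    good = clustering b refl ≤-refl (phases (sweep L) S exceeds b ≤-refl unclustered)
      (result A cB N G ident) (result-exec (width ∘ log) (schedule ∘ log) cB N G ident fits)
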